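{- Let $k$ be a positive integer. Suppose $G$ is an oriented graph whose order $n$ is divisible by $k$ and such that $$\delta(G) \geq \left(1 - \frac{1}{\overrightarrow{TR}(k)}\right) n.$$ Then $G$ contains a perfect $T_k$-packing.
   Context: An oriented graph is a digraph with no loops and at most one directed edge between any pair of distinct vertices. The minimum degree $\delta(G)$ of an oriented graph $G$ is the minimum, over all vertices, of the number of edges (in either direction) incident to the vertex. $T_k$ denotes the transitive tournament on $k$ vertices. A perfect $T_k$-packing in an oriented graph $G$ is a collection of vertex-disjoint copies of $T_k$ in $G$ which covers all the vertices of $G$. The oriented tiling Ramsey number $\overrightarrow{TR}(k)$ is the smallest positive integer $m$ divisible by $k$ such that any orientation of the complete graph $K_m$ contains a perfect $T_k$-packing; it is a known result (due to Erdős) that such an integer exists for every $k$. -}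

module Defs where

open import Data.Nat.Base using (ℕ; _+_; _≤_; NonZero)
open import Data.Nat.Divisibility using (_∣_)
open import Data.Fin.Base as Fin using (Fin)
import Data.Fin.Properties as Fin
open import Data.List.Base using (length; filter; map; allFin)
open import Data.List.Extrema.Nat using (min)
open import Data.Product.Base using (∃₂)
open import Data.Sum.Base using (_⊎_)
open import Function.Definitions using (Injective)
open import Level using (0ℓ)
open import Relation.Binary.Core using (Rel)
open import Relation.Binary.Definitions using (Irreflexive; Asymmetric; Decidable)
open import Relation.Binary.PropositionalEquality using (_≡_; _≢_)

-- Finite graphs are taken on the vertex set Fin n; the edge relation is
-- decidable, which is no restriction classically.
record OrientedGraph (n : ℕ) : Set₁ where
  infix 4 _⟶_ _⟶?_
  field
    _⟶_    : Rel (Fin n) 0ℓ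
    _⟶?_   : Decidable _⟶_
    irrefl : Irreflexive _≡_ _⟶_
    asym   : Asymmetric _⟶_

  outdegree indegree degree : Fin n → ℕ
  outdegree v = length (filter (v ⟶?_) (allFin n))
  indegree  v = length (filter (_⟶? v) (allFin n))
  degree    v = outdegree v + indegree v

-- Every degree is less than n, so the initial value n only matters for the
-- graph with no vertices, whose minimum degree is thereby 0.
δ : ∀ {n} → OrientedGraph n → ℕ
δ {n} G = min n (map (OrientedGraph.degree G) (allFin n))

-- Orientations of the complete graph on n vertices.
IsTournament : ∀ {n} → OrientedGraph n → Set
IsTournament G = ∀ u v → u ≢ v → (u ⟶ v) ⊎ (v ⟶ u)
  where open OrientedGraph G

TransitiveTournament : ∀ k → OrientedGraph k
TransitiveTournament k = record
  { _⟶_    = Fin._<_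
  ; _⟶?_   = Fin._<?_
  ; irrefl = Fin.<-irrefl
  ; asym   = Fin.<-asym
  }

-- A copy of H in G as a (not necessarily induced) subgraph.
record Copy {h n} (H : OrientedGraph h) (G : OrientedGraph n) : Set where
  private
    module H = OrientedGraph H
    module G = OrientedGraph G
  field
    vertex    : Fin h → Fin n
    injective : Injective _≡_ _≡_ vertex
    edge      : ∀ {a b} → a H.⟶ b → vertex a G.⟶ vertex b

open Copy using (vertex)

record PerfectPacking {h n} (H : OrientedGraph h) (G : OrientedGraph n) : Set where
  field
    size     : ℕ
    copy     : Fin size → Copy H G
    disjoint : ∀ {i j} → i ≢ j → ∀ a b → vertex (copy i) a ≢ vertex (copy j) b
    covers   : ∀ v → ∃₂ λ i a → vertex (copy i) a ≡ v

record TournamentsPack (k m : ℕ) : Set₁ where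
  field
    positive  : NonZero m
    divisible : k ∣ m
    packing   : (T : OrientedGraph m) → IsTournament T →
                PerfectPacking (TransitiveTournament k) T

-- m is the oriented tiling Ramsey number of k.
record IsTilingRamseyNumber (k m : ℕ) : Set₁ where
  field
    packs : TournamentsPack k m
    least : ∀ m′ → TournamentsPack k m′ → m ≤ m′

{-# OPTIONS --safe #-}

-- Let q = n / m and call two vertices conflicting when they are not adjacent; every vertex
-- conflicts with fewer than q others, a bound inherited by all sets of vertices. By the
-- Hajnal–Szemerédi theorem any qm vertices are partitioned into q conflict-free classes of
-- size m, that is into q tournaments on m vertices, each of which has a perfect T_k-packing.
-- Hence as long as more than qm vertices remain there is a copy of T_k to remove, and since k
-- divides n and m we can stop with exactly qm vertices, which are packed in the same way.
--
-- For the Hajnal–Szemerédi theorem we follow Kierstead and Kostochka. The edges are inserted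
-- one vertex at a time; each time the new vertex is recoloured, which leaves one class a with
-- a vertex too few and one class b with a vertex too many. A class is accessible when a is
-- reached from it by moving single vertices along a path of classes. If b is accessible,
-- shift along the path. Otherwise counting edges between accessible and inaccessible classes
-- provides either an equitable colouring, by induction on the number of colours, or a nearly
-- equitable one with fewer inaccessible classes.
module Submission where

open import Defs
import Algebra.Properties.Semiring.Sum
open import Data.Bool.Base using (Bool; true; false; _∧_; _∨_; not; if_then_else_)
import Data.Bool.Properties as Bool
open import Data.Empty using (⊥-elim)
open import Data.Fin.Base as Fin using (Fin; zero; suc)
import Data.Fin.Properties as Fin
open import Data.Fin.Properties using (_≟_)
import Data.Integer.Base as ℤ
import Data.Integer.Properties as ℤ
import Data.Integer.Tactic.RingSolver as ℤ-Solver
open import Data.List.Base using (List; []; _∷_; length; filter; tabulate; map; allFin)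
open import Data.List.Extrema.Nat using (min≤xs)
open import Data.List.Membership.Propositional using (_∈_; _∉_)
open import Data.List.Membership.Propositional.Properties using (∈-map⁺; ∈-allFin)
import Data.List.Relation.Unary.All as All
open import Data.List.Relation.Unary.Any using (here; there)
open import Data.Nat.Base
open import Data.Nat.DivMod using (m≡m%n+[m/n]*n; m*n/n≡m; /-monoˡ-≤)
open import Data.Nat.Divisibility using (_∣_; quotient; ∣m+n∣m⇒∣n; ∣n⇒∣m*n)
open import Data.Nat.Induction using (<-wellFounded)
import Data.Nat.Properties as ℕ
open import Data.Nat.Properties hiding (_≟_)
open import Data.Nat.Tactic.RingSolver using (solve-∀)
open import Data.Product.Base using (∃; ∃₂; _×_; _,_; proj₁; proj₂)
import Data.Rational.Base as ℚ
import Data.Rational.Properties as ℚ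
import Data.Rational.Unnormalised.Base as ℚᵘ
import Data.Rational.Unnormalised.Properties as ℚᵘ
open import Data.Sum.Base using (_⊎_; inj₁; inj₂; [_,_]′)
open import Function.Base using (_∘_; id; case_of_)
open import Function.Definitions using (Injective)
open import Induction.WellFounded using (Acc; acc)
open import Relation.Binary.PropositionalEquality
open import Relation.Nullary using (¬_; Dec; yes; no; does; contradiction)
open import Relation.Nullary.Decidable using (dec-true; dec-false; map′; _×-dec_; _⊎-dec_; ¬?)

-- The hard case of the recolouring is the one where the class with the surplus vertex is
-- inaccessible. Let `A` be the `α` accessible classes, `R` the `β` others and `B` the vertices of
-- the latter, `β * s + 1` in number. A vertex of `B` has a neighbour in every accessible class,
-- hence fewer than `β` neighbours in `B`; so `B` without any one vertex `y` can be coloured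
-- equitably with `β` colours, and only a place for `y` among the accessible classes is missing.
-- Such a place arises where `y` has a single neighbour `z` in a class that no other accessible
-- class depends on: `z` leaves and `y` takes over. If `z` can go to another accessible class, the
-- colouring becomes equitable. Otherwise `z` goes to an inaccessible class, and a second such `y`,
-- not adjacent to the first, makes a further class accessible. The obstacle is to find two
-- non-adjacent vertices with the same `z`; they come from a maximal independent set in `B`, whose
-- total number of solo edges exceeds the number of vertices `z` available.

private module ∑ = Algebra.Properties.Semiring.Sum +-*-semiring
open Copy using (vertex; injective; edge)

private variable
  n k : ℕ

-- Booleans and equality tests

∧-intro : ∀ {x y} → x ≡ true → y ≡ true → x ∧ y ≡ true
∧-intro refl refl = refl

∧-elimˡ : ∀ {x y} → x ∧ y ≡ true → x ≡ true
∧-elimˡ = Bool.∧-conicalˡ _ _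

∧-elimʳ : ∀ {x y} → x ∧ y ≡ true → y ≡ true
∧-elimʳ = Bool.∧-conicalʳ _ _

not-true : ∀ {x} → not x ≡ true → x ≡ false
not-true {false} _ = refl

false≢true : ∀ {x} {A : Set} → x ≡ false → x ≡ true → A
false≢true refl ()

infix 7 _==_
_==_ : Fin n → Fin n → Bool
i == j = does (i ≟ j)

==-refl : (i : Fin n) → i == i ≡ true
==-refl i = dec-true (i ≟ i) refl

==-≢ : {i j : Fin n} → i ≢ j → i == j ≡ false
==-≢ {i = i} {j} = dec-false (i ≟ j)

==⇒≡ : {i j : Fin n} → i == j ≡ true → i ≡ j
==⇒≡ {i = i} {j} eq with i ≟ j
... | yes i≡j = i≡j

==-sym : (i j : Fin n) → i == j ≡ j == i
==-sym i j with i ≟ j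
... | yes refl = sym (==-refl i)
... | no i≢j   = sym (==-≢ (i≢j ∘ sym))

==-excluded : ∀ p {i j : Fin n} → (p ≡ true → i ≢ j) → p ∧ i == j ≡ false
==-excluded false _ = refl
==-excluded true i≢j = ==-≢ (i≢j refl)

-- Indicators, finite sums and counting

⟦_⟧ : Bool → ℕ
⟦ false ⟧ = 0
⟦ true ⟧ = 1

⟦∧⟧ : ∀ x y → ⟦ x ∧ y ⟧ ≡ ⟦ x ⟧ * ⟦ y ⟧
⟦∧⟧ false y = refl
⟦∧⟧ true  y = sym (+-identityʳ _)

⟦⟧≤1 : ∀ x → ⟦ x ⟧ ≤ 1
⟦⟧≤1 false = z≤n
⟦⟧≤1 true  = ≤-refl

∧-split : ∀ x y → ⟦ x ∧ y ⟧ + ⟦ x ∧ not y ⟧ ≡ ⟦ x ⟧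
∧-split false y     = refl
∧-split true  false = refl
∧-split true  true  = refl

-- Opaque, because the library's sum unfolds to a fold and defeats the inference of summands.
opaque
  sum : (Fin n → ℕ) → ℕ
  sum = ∑.sum

  sum-cong-≗ : {f g : Fin n → ℕ} → (∀ i → f i ≡ g i) → sum f ≡ sum g
  sum-cong-≗ = ∑.sum-cong-≗

  sum-zero : ∀ n → sum {n} (λ _ → 0) ≡ 0
  sum-zero = ∑.sum-replicate-zero

  ∑-distrib-+ : (f g : Fin n → ℕ) → sum (λ i → f i + g i) ≡ sum f + sum g
  ∑-distrib-+ = ∑.∑-distrib-+

  ∑-comm : (f : Fin n → Fin k → ℕ) → sum (λ i → sum (f i)) ≡ sum (λ j → sum (λ i → f i j))
  ∑-comm = ∑.∑-comm

  *-distribˡ-sum : ∀ c (f : Fin n → ℕ) → c * sum f ≡ sum (λ i → c * f i)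
  *-distribˡ-sum = ∑.*-distribˡ-sum

  *-distribʳ-sum : ∀ c (f : Fin n → ℕ) → sum f * c ≡ sum (λ i → f i * c)
  *-distribʳ-sum = ∑.*-distribʳ-sum

  sum-mono : {f g : Fin n → ℕ} → (∀ i → f i ≤ g i) → sum f ≤ sum g
  sum-mono {zero}  f≤g = z≤n
  sum-mono {suc n} f≤g = +-mono-≤ (f≤g zero) (sum-mono (f≤g ∘ suc))

  sum-const : ∀ n c → sum {n} (λ _ → c) ≡ n * c
  sum-const zero    c = refl
  sum-const (suc n) c = cong (c +_) (sum-const n c)

  sum-select : ∀ (j : Fin n) (g : Fin n → ℕ) → sum (λ i → ⟦ i == j ⟧ * g i) ≡ g j
  sum-select {suc n} zero g =
    trans (cong₂ _+_ (+-identityʳ (g zero)) (sum-zero n)) (+-identityʳ (g zero))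
  sum-select {suc n} (suc j) g = trans (sum-cong-≗ same) (sum-select j (g ∘ suc))
    where
    same : ∀ i → ⟦ suc i == suc j ⟧ * g (suc i) ≡ ⟦ i == j ⟧ * g (suc i)
    same i with i ≟ j
    ... | yes _ = refl
    ... | no  _ = refl

count : (Fin n → Bool) → ℕ
count p = sum (⟦_⟧ ∘ p)

sum-pigeonhole : {f g : Fin n → ℕ} → sum f < sum g → ∃ λ i → f i < g i
sum-pigeonhole {f = f} {g} f<g with Fin.any? (λ i → f i <? g i)
... | yes ex = ex
... | no ∄ = contradiction f<g (≤⇒≯ (sum-mono λ i → ≮⇒≥ λ fi<gi → ∄ (i , fi<gi)))

sum-singleton : ∀ (j : Fin n) c → sum (λ i → ⟦ i == j ⟧ * c) ≡ c
sum-singleton j c = sum-select j (λ _ → c)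

count-singleton : (j : Fin n) → count (_== j) ≡ 1
count-singleton j = trans (sum-cong-≗ λ i → sym (*-identityʳ _)) (sum-singleton j 1)

⟦⟧-mono : ∀ {x y} → (x ≡ true → y ≡ true) → ⟦ x ⟧ ≤ ⟦ y ⟧
⟦⟧-mono {false} imp = z≤n
⟦⟧-mono {true}  imp rewrite imp refl = ≤-refl

count-mono : {p q : Fin n → Bool} → (∀ i → p i ≡ true → q i ≡ true) → count p ≤ count q
count-mono p⊆q = sum-mono λ i → ⟦⟧-mono (p⊆q i)

count-cong : {p q : Fin n → Bool} → (∀ i → p i ≡ q i) → count p ≡ count q
count-cong p≗q = sum-cong-≗ (cong ⟦_⟧ ∘ p≗q)

count-split : (p q : Fin n → Bool) →
  count (λ i → p i ∧ q i) + count (λ i → p i ∧ not (q i)) ≡ count p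
count-split p q = trans (sym (∑-distrib-+ _ _)) (sum-cong-≗ λ i → ∧-split (p i) (q i))

count-remove : (p : Fin n) {q : Fin n → Bool} → q p ≡ true →
  count q ≡ suc (count (λ i → q i ∧ not (i == p)))
count-remove p {q} qp = begin
  count q                                   ≡⟨ count-split q (_== p) ⟨
  count (λ i → q i ∧ i == p) + count q∖p    ≡⟨ cong (_+ count q∖p) (count-cong at-p) ⟩
  count (_== p) + count q∖p                 ≡⟨ cong (_+ count q∖p) (count-singleton p) ⟩
  suc (count q∖p)                           ∎
  where
  open ≡-Reasoning
  q∖p : Fin _ → Bool
  q∖p i = q i ∧ not (i == p)
  at-p : ∀ i → q i ∧ i == p ≡ i == p
  at-p i with i ≟ p
  ... | yes refl = cong (_∧ true) qp
  ... | no  _    = Bool.∧-zeroʳ (q i)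

count>0⇒∃ : {p : Fin n → Bool} → 0 < count p → ∃ λ i → p i ≡ true
count>0⇒∃ {n} {p} pos with sum-pigeonhole {f = λ _ → 0} {⟦_⟧ ∘ p}
                             (subst (_< count p) (sym (sum-zero n)) pos)
... | i , 0<pi with p i in eq
...   | true = i , eq

∃⇒count>0 : {p : Fin n → Bool} → ∀ i → p i ≡ true → 0 < count p
∃⇒count>0 i pi = subst (0 <_) (sym (count-remove i pi)) z<s

count≥2⇒∃₂ : {p : Fin n → Bool} → 2 ≤ count p → ∃₂ λ i j → i ≢ j × p i ≡ true × p j ≡ true
count≥2⇒∃₂ {p = p} 2≤p with count>0⇒∃ (<-trans z<s 2≤p)
... | i , pi with count>0⇒∃ (s<s⁻¹ (subst (2 ≤_) (count-remove i pi) 2≤p))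
...   | j , pj = i , j , (λ { refl → false≢true (cong not (==-refl i)) (∧-elimʳ pj) }) , pi , ∧-elimˡ pj

count≡0⇒false : {p : Fin n → Bool} → count p ≡ 0 → ∀ i → p i ≡ false
count≡0⇒false {p = p} p≡0 i with p i in eq
... | false = refl
... | true  = contradiction p≡0 (>⇒≢ (∃⇒count>0 i eq))

count-strict : {p q : Fin n → Bool} → (∀ i → p i ≡ true → q i ≡ true) →
  ∀ j → q j ≡ true → p j ≡ false → count p < count q
count-strict {p = p} {q} p⊆q j qj pj = subst (count p <_) (sym (count-remove j qj)) (s≤s (count-mono p⊆q∖j))
  where
  p⊆q∖j : ∀ i → p i ≡ true → q i ∧ not (i == j) ≡ true
  p⊆q∖j i pi with i ≟ j
  ... | yes refl = false≢true pj pi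
  ... | no  _    = ∧-intro (p⊆q i pi) refl

-- Exchanging the two sums leaves, for each `v`, only the term of its own class `f v`.
sum-fibres : ∀ {n k} (f : Fin n → Fin k) (p : Fin n → Bool) (w : Fin k → ℕ) →
  sum (λ x → w x * count (λ v → p v ∧ f v == x)) ≡ sum (λ v → w (f v) * ⟦ p v ⟧)
sum-fibres f p w = begin
  sum (λ x → w x * count (λ v → p v ∧ f v == x))
    ≡⟨ sum-cong-≗ (λ x → *-distribˡ-sum (w x) _) ⟩
  sum (λ x → sum (λ v → w x * ⟦ p v ∧ f v == x ⟧))
    ≡⟨ ∑-comm _ ⟩
  sum (λ v → sum (λ x → w x * ⟦ p v ∧ f v == x ⟧))
    ≡⟨ sum-cong-≗ (λ v → trans (sum-cong-≗ (λ x → flip-select v x))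
                               (sum-select (f v) (λ x → w x * ⟦ p v ⟧))) ⟩
  sum (λ v → w (f v) * ⟦ p v ⟧) ∎
  where
  open ≡-Reasoning
  flip-select : ∀ v x → w x * ⟦ p v ∧ f v == x ⟧ ≡ ⟦ x == f v ⟧ * (w x * ⟦ p v ⟧)
  flip-select v x with f v ≟ x
  ... | yes refl rewrite ==-refl (f v) | Bool.∧-identityʳ (p v) = sym (+-identityʳ _)
  ... | no f≢x rewrite ==-≢ (f≢x ∘ sym) | Bool.∧-zeroʳ (p v) = *-zeroʳ (w x)

-- Turns totals over classes, of sizes or of neighbour counts, into numbers of vertices whose colour
-- lies in `d`.
count-fibres : ∀ {n k} (f : Fin n → Fin k) (p : Fin n → Bool) (d : Fin k → Bool) →
  sum (λ x → ⟦ d x ⟧ * count (λ v → p v ∧ f v == x)) ≡ count (λ v → p v ∧ d (f v))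
count-fibres f p d = trans (sum-fibres f p (⟦_⟧ ∘ d))
  (sum-cong-≗ λ v → trans (*-comm ⟦ d (f v) ⟧ ⟦ p v ⟧) (sym (⟦∧⟧ (p v) (d (f v)))))

⟦⟧*-mono : ∀ {x} {a b : ℕ} → (x ≡ true → a ≤ b) → ⟦ x ⟧ * a ≤ ⟦ x ⟧ * b
⟦⟧*-mono {false} a≤b = z≤n
⟦⟧*-mono {true}  a≤b = +-monoˡ-≤ 0 (a≤b refl)

sum-weighted : (p : Fin n → Bool) (c : ℕ) → sum (λ i → ⟦ p i ⟧ * c) ≡ count p * c
sum-weighted p c = sym (*-distribʳ-sum c (⟦_⟧ ∘ p))

-- Growing and choosing finite subsets

insert : Fin n → (Fin n → Bool) → Fin n → Bool
insert i s j = j == i ∨ s j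

insert-elim : ∀ (i : Fin n) s {A : Set} {j} → (j ≡ i → A) → (s j ≡ true → A) → insert i s j ≡ true → A
insert-elim i s {j = j} at-i in-s eq with j ≟ i
... | yes j≡i = at-i j≡i
... | no  _   = in-s eq

insert-here : ∀ (i : Fin n) s → insert i s i ≡ true
insert-here i s rewrite ==-refl i = refl

insert-there : ∀ (i : Fin n) s {j} → s j ≡ true → insert i s j ≡ true
insert-there i s {j} sj rewrite sj = Bool.∨-zeroʳ (j == i)

insert-∉ : ∀ {i : Fin n} s {j} → j ≢ i → s j ≡ false → insert i s j ≡ false
insert-∉ s j≢i sj rewrite ==-≢ j≢i = sj

-- Terminates because the complement of `s` shrinks. It is the common loop of four greedy
-- constructions: accessible classes, a maximal independent set, the insertion of edges, and the
-- union of packings over fibres.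
saturate : {A : Set} (Inv : (Fin n → Bool) → Set) →
  (∀ s → Inv s → A ⊎ ∃ λ i → s i ≡ false × Inv (insert i s)) →
  ∀ s → Inv s → A
saturate {A = A} Inv grow s = go s (<-wellFounded _)
  where
  go : ∀ s → Acc _<_ (count (not ∘ s)) → Inv s → A
  go s (acc rec) inv with grow s inv
  ... | inj₁ a = a
  ... | inj₂ (i , si , inv′) = go (insert i s) (rec (count-strict
          (λ j nj → cong not (old j nj)) i (cong not si) (cong not (insert-here i s)))) inv′
    where
    old : ∀ j → not (insert i s j) ≡ true → s j ≡ false
    old j nj = Bool.∨-conicalʳ (j == i) _ (not-true nj)

subset : (p : Fin n → Bool) (j : ℕ) → j ≤ count p →
  ∃ λ q → (∀ i → q i ≡ true → p i ≡ true) × count q ≡ j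
subset {n} p zero j≤ = (λ _ → false) , (λ _ ()) , sum-zero n
subset p (suc j) j≤ with subset p j (<⇒≤ j≤)
... | q , q⊆p , q≡j with sum-pigeonhole {f = ⟦_⟧ ∘ q} {⟦_⟧ ∘ p} (subst (_< count p) (sym q≡j) j≤)
...   | i , q<p = insert i q , (λ j → insert-elim i q (λ { refl → pi }) (q⊆p j)) ,
                  trans (count-remove i (insert-here i q)) (cong suc (trans (count-cong same) q≡j))
  where
  pi : p i ≡ true
  pi with p i
  ... | true = refl
  ... | false = contradiction q<p λ ()
  qi : q i ≡ false
  qi with q i
  ... | false = refl
  ... | true = contradiction q<p (≤⇒≯ (⟦⟧≤1 (p i)))
  same : ∀ j → insert i q j ∧ not (j == i) ≡ q j
  same j with j ≟ i
  ... | yes refl = sym qi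
  ... | no  _ = Bool.∧-identityʳ (q j)

opaque
  unfolding sum

  -- The members of `p` are handed out one by one, each to a class whose quota is still positive;
  -- `d` is the colour of everything outside `p`.
  prescribed-fibres : ∀ {n k} → Fin k → (p : Fin n → Bool) (t : Fin k → ℕ) → sum t ≡ count p →
    ∃ λ (f : Fin n → Fin k) → ∀ x → count (λ v → p v ∧ f v == x) ≡ t x
  prescribed-fibres {zero} d p t t≡ = (λ ()) , λ x → sym (sum≡0 t t≡ x)
    where
    sum≡0 : ∀ {k} (t : Fin k → ℕ) → sum t ≡ 0 → ∀ x → t x ≡ 0
    sum≡0 t t≡ zero    = m+n≡0⇒m≡0 (t zero) t≡
    sum≡0 t t≡ (suc x) = sum≡0 (t ∘ suc) (m+n≡0⇒n≡0 (t zero) t≡) x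
  prescribed-fibres {suc n} {k} d p t t≡ with p zero
  ... | false with prescribed-fibres d (p ∘ suc) t t≡
  ...   | f , f≡ = (λ { zero → d ; (suc v) → f v }) , f≡
  prescribed-fibres {suc n} {k} d p t t≡ | true
    with sum-pigeonhole {f = λ _ → 0} {t} (subst₂ _<_ (sym (sum-zero k)) (sym t≡) z<s)
  ... | x , 0<tx with prescribed-fibres d (p ∘ suc) (λ y → t y ∸ ⟦ y == x ⟧) t∸≡
    where
    restore : ∀ y → t y ∸ ⟦ y == x ⟧ + ⟦ y == x ⟧ * 1 ≡ t y
    restore y with y ≟ x
    ... | yes refl = m∸n+n≡m 0<tx
    ... | no  _    = +-identityʳ (t y)
    t∸≡ : sum (λ y → t y ∸ ⟦ y == x ⟧) ≡ count (p ∘ suc)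
    t∸≡ = suc-injective (begin
      suc (sum (λ y → t y ∸ ⟦ y == x ⟧))
        ≡⟨ +-comm 1 _ ⟩
      sum (λ y → t y ∸ ⟦ y == x ⟧) + 1
        ≡⟨ cong (sum (λ y → t y ∸ ⟦ y == x ⟧) +_) (sum-singleton x 1) ⟨
      sum (λ y → t y ∸ ⟦ y == x ⟧) + sum (λ y → ⟦ y == x ⟧ * 1)
        ≡⟨ ∑-distrib-+ (λ y → t y ∸ ⟦ y == x ⟧) (λ y → ⟦ y == x ⟧ * 1) ⟨
      sum (λ y → t y ∸ ⟦ y == x ⟧ + ⟦ y == x ⟧ * 1)
        ≡⟨ sum-cong-≗ restore ⟩
      sum t
        ≡⟨ t≡ ⟩
      suc (count (p ∘ suc)) ∎)
      where open ≡-Reasoning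
  ...   | f , f≡ = (λ { zero → x ; (suc v) → f v }) , λ y →
          trans (cong (⟦ x == y ⟧ +_) (f≡ y)) (total y)
    where
    total : ∀ y → ⟦ x == y ⟧ + (t y ∸ ⟦ y == x ⟧) ≡ t y
    total y with x ≟ y
    ... | yes refl rewrite ==-refl x = m+[n∸m]≡n 0<tx
    ... | no  x≢y rewrite ==-≢ (x≢y ∘ sym) = refl

-- Corrections on both sides avoid truncated subtraction and let a change of class sizes be checked
-- vertex by vertex.
count-exchange : {p q : Fin n → Bool} (i j : Fin n) (x y : Bool) →
  (∀ u → ⟦ p u ⟧ + ⟦ u == i ⟧ * ⟦ x ⟧ ≡ ⟦ q u ⟧ + ⟦ u == j ⟧ * ⟦ y ⟧) →
  count p + ⟦ x ⟧ ≡ count q + ⟦ y ⟧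
count-exchange {p = p} {q} i j x y eq = begin
  count p + ⟦ x ⟧                                   ≡⟨ cong (count p +_) (sum-singleton i ⟦ x ⟧) ⟨
  count p + sum (λ u → ⟦ u == i ⟧ * ⟦ x ⟧)          ≡⟨ ∑-distrib-+ _ _ ⟨
  sum (λ u → ⟦ p u ⟧ + ⟦ u == i ⟧ * ⟦ x ⟧)          ≡⟨ sum-cong-≗ eq ⟩
  sum (λ u → ⟦ q u ⟧ + ⟦ u == j ⟧ * ⟦ y ⟧)          ≡⟨ ∑-distrib-+ _ _ ⟩
  count q + sum (λ u → ⟦ u == j ⟧ * ⟦ y ⟧)          ≡⟨ cong (count q +_) (sum-singleton j ⟦ y ⟧) ⟩
  count q + ⟦ y ⟧                                   ∎
  where open ≡-Reasoning

count-extend : {p q : Fin n → Bool} (i : Fin n) (x : Bool) →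
  (∀ u → ⟦ p u ⟧ ≡ ⟦ q u ⟧ + ⟦ u == i ⟧ * ⟦ x ⟧) → count p ≡ count q + ⟦ x ⟧
count-extend {p = p} {q} i x eq = begin
  count p                                   ≡⟨ sum-cong-≗ eq ⟩
  sum (λ u → ⟦ q u ⟧ + ⟦ u == i ⟧ * ⟦ x ⟧)  ≡⟨ ∑-distrib-+ _ _ ⟩
  count q + sum (λ u → ⟦ u == i ⟧ * ⟦ x ⟧)  ≡⟨ cong (count q +_) (sum-singleton i ⟦ x ⟧) ⟩
  count q + ⟦ x ⟧                           ∎
  where open ≡-Reasoning

term≤sum : ∀ (f : Fin n → ℕ) i → f i ≤ sum f
term≤sum f i = subst (_≤ sum f) (sum-select i f) (sum-mono λ j → select≤ (j == i) (f j))
  where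
  select≤ : ∀ x m → ⟦ x ⟧ * m ≤ m
  select≤ false m = z≤n
  select≤ true  m = ≤-reflexive (+-identityʳ m)

count≡1⇒unique : {p : Fin n → Bool} → count p ≡ 1 → ∀ {i j} → p i ≡ true → p j ≡ true → j ≡ i
count≡1⇒unique {p = p} one {i} {j} pi pj with j ≟ i
... | yes j≡i = j≡i
... | no  j≢i = contradiction
  (∃⇒count>0 {p = λ u → p u ∧ not (u == i)} j (∧-intro pj (cong not (==-≢ j≢i))))
  (≤⇒≯ (≤-reflexive (suc-injective (trans (sym (count-remove i pi)) one))))

-- Graphs, partial colourings and shifts along paths of classes

record Graph (n : ℕ) : Set where
  field
    adj       : Fin n → Fin n → Bool
    adj-sym   : ∀ u v → adj u v ≡ adj v u
    adj-irr   : ∀ v → adj v v ≡ false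

-- Colourings of the subgraph induced on P; the values outside P are irrelevant.
module Colouring {n k : ℕ} (G : Graph n) (P : Fin n → Bool) where
  open Graph G

  Proper : (Fin n → Fin k) → Set
  Proper f = ∀ u v → P u ≡ true → P v ≡ true → adj u v ≡ true → f u ≢ f v

  size : (Fin n → Fin k) → Fin k → ℕ
  size f X = count λ v → P v ∧ f v == X

  nb : (Fin n → Fin k) → Fin n → Fin k → ℕ
  nb f v X = count λ u → (P u ∧ adj v u) ∧ f u == X

  -- v is movable to the class X.
  Free : (Fin n → Fin k) → Fin n → Fin k → Set
  Free f v X = ∀ u → P u ≡ true → adj v u ≡ true → f u ≢ X

  nb≡0⇒Free : ∀ {f v X} → nb f v X ≡ 0 → Free f v X
  nb≡0⇒Free {f} nb≡0 u Pu vu refl =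
    false≢true (count≡0⇒false nb≡0 u) (∧-intro (∧-intro Pu vu) (==-refl (f u)))

  Free⇒nb≡0 : ∀ {f v X} → Free f v X → nb f v X ≡ 0
  Free⇒nb≡0 {f} {v} {X} free with nb f v X in eq
  ... | zero = refl
  ... | suc _ with count>0⇒∃ {p = λ u → (P u ∧ adj v u) ∧ f u == X} (subst (0 <_) (sym eq) z<s)
  ...   | u , t = contradiction (==⇒≡ (∧-elimʳ t)) (free u (∧-elimˡ (∧-elimˡ t)) (∧-elimʳ {P u} (∧-elimˡ t)))

  free? : ∀ f v X → Dec (Free f v X)
  free? f v X = map′ nb≡0⇒Free Free⇒nb≡0 (nb f v X ℕ.≟ 0)

  ¬Free⇒nb>0 : ∀ {f v X} → ¬ Free f v X → 0 < nb f v X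
  ¬Free⇒nb>0 ¬free = n≢0⇒n>0 (¬free ∘ nb≡0⇒Free)

  recolour : (Fin n → Fin k) → Fin n → Fin k → Fin n → Fin k
  recolour f v X u = if u == v then X else f u

  recolour-same : ∀ f v X → recolour f v X v ≡ X
  recolour-same f v X rewrite ==-refl v = refl

  recolour-other : ∀ f v X {u} → u ≢ v → recolour f v X u ≡ f u
  recolour-other f v X u≢v rewrite ==-≢ u≢v = refl

  -- Edges at `v` are exempt from the first hypothesis because `Free` alone judges them. Thus the
  -- old colour of `v` may be meaningless, or shared with a neighbour.
  recolour-proper : ∀ {f v X} →
    (∀ u w → u ≢ v → w ≢ v → P u ≡ true → P w ≡ true → adj u w ≡ true → f u ≢ f w) →
    Free f v X → Proper (recolour f v X)
  recolour-proper {f} {v} {X} prop free u w Pu Pw uw with u ≟ v | w ≟ v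
  ... | yes refl | yes refl = false≢true (adj-irr u) uw
  ... | yes refl | no w≢v   = free w Pw uw ∘ sym
  ... | no u≢v   | yes refl = free u Pu (trans (adj-sym w u) uw)
  ... | no u≢v   | no w≢v   = prop u w u≢v w≢v Pu Pw uw

  recolour-size : ∀ f v X Z → P v ≡ true →
    size (recolour f v X) Z + ⟦ f v == Z ⟧ ≡ size f Z + ⟦ X == Z ⟧
  recolour-size f v X Z Pv = count-exchange v v (f v == Z) (X == Z) pointwise
    where
    pointwise : ∀ u → ⟦ P u ∧ recolour f v X u == Z ⟧ + ⟦ u == v ⟧ * ⟦ f v == Z ⟧
                    ≡ ⟦ P u ∧ f u == Z ⟧ + ⟦ u == v ⟧ * ⟦ X == Z ⟧
    pointwise u with u ≟ v
    ... | no _ = refl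
    ... | yes refl rewrite Pv | +-identityʳ ⟦ f u == Z ⟧ | +-identityʳ ⟦ X == Z ⟧ =
      +-comm ⟦ X == Z ⟧ ⟦ f u == Z ⟧

  -- A simple path of movable vertices from a class to the class a;
  -- the list holds the classes after the first.
  data Path (f : Fin n → Fin k) (a : Fin k) : Fin k → List (Fin k) → Set where
    done : Path f a a []
    step : ∀ {X Y L} y → P y ≡ true → f y ≡ X → Free f y Y → X ∉ Y ∷ L →
           Path f a Y L → Path f a X (Y ∷ L)

  path-end : ∀ {f a X L} → Path f a X L → a ∈ X ∷ L
  path-end done                  = here refl
  path-end (step _ _ _ _ _ path) = there (path-end path)

  path-simple : ∀ {f a X L} → Path f a X L → X ∉ L
  path-simple done = λ ()
  path-simple (step _ _ _ _ X∉ _) = X∉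

  -- A witness must stay in its class, and a class that a move enters must gain no vertex. The first
  -- class is never entered, so it may gain vertices.
  path-cong : ∀ {f g a X L} →
    (∀ v → P v ≡ true → f v ∈ X ∷ L → g v ≡ f v) →
    (∀ v → P v ≡ true → g v ∈ L → f v ≡ g v) →
    Path f a X L → Path g a X L
  path-cong f⇒g g⇒f done = done
  path-cong {f} {g} f⇒g g⇒f (step {X} {Y} y Py fy free X∉ path) =
    step y Py (trans (f⇒g y Py (here fy)) fy)
      (λ u Pu yu gu → free u Pu yu (trans (g⇒f u Pu (here gu)) gu)) X∉
      (path-cong (λ v Pv fv∈ → f⇒g v Pv (there fv∈)) (λ v Pv gv∈ → g⇒f v Pv (there gv∈)) path)

  -- `Y` gains `y`, but `Y` begins the remaining path, and a simple path never moves a vertex into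
  -- its first class.
  recolour-path : ∀ {f a X Y L y} → f y ≡ X → X ∉ Y ∷ L → Path f a Y L →
    Path (recolour f y Y) a Y L
  recolour-path {f} {a} {X} {Y} {L} {y} fy X∉ path = path-cong f⇒g g⇒f path
    where
    f⇒g : ∀ v → P v ≡ true → f v ∈ Y ∷ L → recolour f y Y v ≡ f v
    f⇒g v _ fv∈ = recolour-other f y Y λ { refl → X∉ (subst (_∈ Y ∷ L) fy fv∈) }
    g⇒f : ∀ v → P v ≡ true → recolour f y Y v ∈ L → f v ≡ recolour f y Y v
    g⇒f v _ gv∈ with v ≟ y
    ... | yes refl = contradiction gv∈ (path-simple path)
    ... | no _ = refl

  record Shifted (f : Fin n → Fin k) (a X : Fin k) (L : List (Fin k)) : Set where
    field
      colour  : Fin n → Fin k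
      proper  : Proper colour
      sizes   : ∀ Z → size colour Z + ⟦ X == Z ⟧ ≡ size f Z + ⟦ a == Z ⟧
      local   : ∀ v → colour v ≡ f v ⊎ (f v ∈ X ∷ L × colour v ∈ X ∷ L)

  shift : ∀ {f a X L} → Proper f → Path f a X L → Shifted f a X L
  shift {L = []} prop done = record
    { colour = _ ; proper = prop ; sizes = λ _ → refl ; local = λ _ → inj₁ refl }
  shift {f} {a} {X} {Y ∷ L} prop (step y Py fy free X∉ path) = record
    { colour = S.colour
    ; proper = S.proper
    ; sizes  = sizes
    ; local  = local
    }
    where
    g = recolour f y Y
    module S = Shifted (shift (recolour-proper (λ u w _ _ → prop u w) free) (recolour-path fy X∉ path))
    sizes : ∀ Z → size S.colour Z + ⟦ X == Z ⟧ ≡ size f Z + ⟦ a == Z ⟧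
    -- `Y` receives `y` and is the start of the remaining shift; the two corrections at `Y` cancel.
    sizes Z = +-cancelʳ-≡ ⟦ Y == Z ⟧ _ _ (begin
      size S.colour Z + ⟦ X == Z ⟧ + ⟦ Y == Z ⟧  ≡⟨ swap (size S.colour Z) _ _ ⟩
      size S.colour Z + ⟦ Y == Z ⟧ + ⟦ X == Z ⟧  ≡⟨ cong (_+ ⟦ X == Z ⟧) (S.sizes Z) ⟩
      size g Z + ⟦ a == Z ⟧ + ⟦ X == Z ⟧         ≡⟨ swap (size g Z) _ _ ⟩
      size g Z + ⟦ X == Z ⟧ + ⟦ a == Z ⟧         ≡⟨ cong (λ W → size g Z + ⟦ W == Z ⟧ + ⟦ a == Z ⟧) fy ⟨
      size g Z + ⟦ f y == Z ⟧ + ⟦ a == Z ⟧       ≡⟨ cong (_+ ⟦ a == Z ⟧) (recolour-size f y Y Z Py) ⟩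
      size f Z + ⟦ Y == Z ⟧ + ⟦ a == Z ⟧         ≡⟨ swap (size f Z) _ _ ⟩
      size f Z + ⟦ a == Z ⟧ + ⟦ Y == Z ⟧         ∎)
      where
      open ≡-Reasoning
      swap : ∀ x y z → x + y + z ≡ x + z + y
      swap = solve-∀
    local : ∀ v → S.colour v ≡ f v ⊎ (f v ∈ X ∷ Y ∷ L × S.colour v ∈ X ∷ Y ∷ L)
    local v with v ≟ y | S.local v
    ... | no  _    | inj₁ eq        = inj₁ eq
    ... | no  _    | inj₂ (g∈ , c∈) = inj₂ (there g∈ , there c∈)
    ... | yes refl | inj₁ eq        = inj₂ (here fy , there (here eq))
    ... | yes refl | inj₂ (_ , c∈)  = inj₂ (here fy , there c∈)

  -- Nothing enters `X` during the shift, since the path is simple. Hence the vacated class can take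
  -- in a vertex whose only neighbour there was `y`.
  shift-head : ∀ {f a X Y L y} (prop : Proper f) (Py : P y ≡ true) (fy : f y ≡ X)
    (free : Free f y Y) (X∉ : X ∉ Y ∷ L) (path : Path f a Y L) →
    ∀ v → Shifted.colour (shift prop (step y Py fy free X∉ path)) v ≡ X → f v ≡ X × v ≢ y
  shift-head {Y = Y} {L} {y} prop Py fy free X∉ path v cv
    with v ≟ y | Shifted.local (shift (recolour-proper (λ u w _ _ → prop u w) free) (recolour-path fy X∉ path)) v
  ... | no  v≢y  | inj₁ eq       = trans (sym eq) cv , v≢y
  ... | yes refl | inj₁ eq       = contradiction (here (trans (sym cv) eq)) X∉
  ... | _        | inj₂ (_ , c∈) = contradiction (subst (_∈ Y ∷ L) cv c∈) X∉

  -- `D` limits the classes that paths may use: `C` gives the accessible classes, `C` without `W`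
  -- those that reach `a` around `W`. If `a` itself is excluded, `set` is empty.
  record Reach (f : Fin n → Fin k) (a : Fin k) (D : Fin k → Bool) : Set where
    field
      set    : Fin k → Bool
      path   : ∀ {X} → set X ≡ true → ∃ λ L → Path f a X L × (∀ {Y} → Y ∈ X ∷ L → set Y ≡ true)
      within : ∀ {X} → set X ≡ true → D X ≡ true
      root   : D a ≡ true → set a ≡ true
      closed : ∀ {y X Y} → D X ≡ true → P y ≡ true → f y ≡ X → set Y ≡ true → Free f y Y → set X ≡ true

    complete : ∀ {X L} → Path f a X L → (∀ {Y} → Y ∈ X ∷ L → D Y ≡ true) → set X ≡ true
    complete done D∀ = root (D∀ (here refl))
    complete (step y Py fy free _ p) D∀ = closed (D∀ (here refl)) Py fy (complete p (D∀ ∘ there)) free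

    root∈ : ∀ {X} → set X ≡ true → set a ≡ true
    root∈ SX with path SX
    ... | L , p , S∀ = S∀ (path-end p)

  opaque
    reach : ∀ f a D → Reach f a D
    reach f a D = saturate Inv grow (λ _ → false) ((λ ()) , (λ ()))
      where
      Inv : (Fin k → Bool) → Set
      Inv S = (∀ {X} → S X ≡ true → ∃ λ L → Path f a X L × (∀ {Y} → Y ∈ X ∷ L → S Y ≡ true))
            × (∀ {X} → S X ≡ true → D X ≡ true)

      Movable : (Fin k → Bool) → Fin k → Set
      Movable S X = ∃₂ λ y Y → P y ≡ true × f y ≡ X × S Y ≡ true × Free f y Y

      movable? : ∀ S X → Dec (Movable S X)
      movable? S X = Fin.any? λ y → Fin.any? λ Y →
        (P y Bool.≟ true) ×-dec (f y ≟ X) ×-dec (S Y Bool.≟ true) ×-dec free? f y Y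

      grow : ∀ S → Inv S → Reach f a D ⊎ ∃ λ X → S X ≡ false × Inv (insert X S)
      grow S (paths , S⊆D)
        with Fin.any? (λ X → (S X Bool.≟ false) ×-dec (D X Bool.≟ true) ×-dec ((X ≟ a) ⊎-dec movable? S X))
      ... | yes (X , SX , DX , new) = inj₂ (X , SX , paths′ , λ {Y} → insert-elim X S (λ { refl → DX }) S⊆D)
        where
        pathX : X ≡ a ⊎ Movable S X → ∃ λ L → Path f a X L × (∀ {Y} → Y ∈ L → S Y ≡ true)
        pathX (inj₁ refl) = [] , done , λ ()
        pathX (inj₂ (y , Y , Py , fy , SY , free)) with paths SY
        -- `X` is new to `S` while the earlier path stays inside `S`, so the extended path is
        -- simple.
        ... | L , p , S∀ = Y ∷ L , step y Py fy free (λ X∈ → false≢true SX (S∀ X∈)) p , S∀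
        paths′ : ∀ {Z} → insert X S Z ≡ true →
                 ∃ λ L → Path f a Z L × (∀ {Y} → Y ∈ Z ∷ L → insert X S Y ≡ true)
        paths′ {Z} = insert-elim X S
          (λ { refl → case pathX new of λ (L , p , S∀) →
                 L , p , λ { {_} (here refl) → insert-here X S ; {_} (there Y∈) → insert-there X S (S∀ Y∈) } })
          (λ SZ → case paths SZ of λ (L , p , S∀) → L , p , λ {_} Y∈ → insert-there X S (S∀ Y∈))
      ... | no ∄ = inj₁ record
        { set    = S
        ; path   = paths
        ; within = S⊆D
        ; root   = λ Da → decide a λ Sa → ∄ (a , Sa , Da , inj₁ refl)
        ; closed = λ {y} {X} {Y} DX Py fy SY free →
                     decide X λ SX → ∄ (X , SX , DX , inj₂ (y , Y , Py , fy , SY , free))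
        }
        where
        decide : ∀ X → ¬ (S X ≡ false) → S X ≡ true
        decide X ¬SX with S X
        ... | true  = refl
        ... | false = contradiction refl ¬SX

-- Vertices and colours are subsets `P` and `C` of fixed types, so that the induction on the number
-- of colours, which passes to subsets of both, never changes a type.
record Equitable {n k} (G : Graph n) (P : Fin n → Bool) (C : Fin k → Bool) (s : ℕ) : Set where
  open Colouring {k = k} G P
  field
    colour  : Fin n → Fin k
    colour∈ : ∀ v → P v ≡ true → C (colour v) ≡ true
    proper  : Proper colour
    sizes   : ∀ X → C X ≡ true → size colour X ≡ s

DegreeBelow : Graph n → (Fin n → Bool) → ℕ → Set
DegreeBelow G P c = ∀ v → P v ≡ true → count (λ u → P u ∧ Graph.adj G v u) < c

-- Lets each of the four indicators in a size equation be evaluated by an equation of its own; what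
-- remains is an identity between their values.
balance : ∀ {e₁ e₂ e₃ e₄ w} (x₁ x₂ x₃ x₄ : Bool) → e₁ ≡ x₁ → e₂ ≡ x₂ → e₃ ≡ x₃ → e₄ ≡ x₄ →
  ⟦ x₁ ⟧ + ⟦ x₂ ⟧ * w ≡ ⟦ x₃ ⟧ + ⟦ x₄ ⟧ * w → ⟦ e₁ ⟧ + ⟦ e₂ ⟧ * w ≡ ⟦ e₃ ⟧ + ⟦ e₄ ⟧ * w
balance _ _ _ _ refl refl refl refl eq = eq

-- Gluing two colourings

glue : (Fin n → Bool) → (Fin n → Fin k) → (Fin n → Fin k) → Fin n → Fin k
glue Q f g v = if Q v then f v else g v

glue-true : ∀ Q (f g : Fin n → Fin k) {v} → Q v ≡ true → glue Q f g v ≡ f v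
glue-true Q f g {v} Qv = cong (λ x → if x then f v else g v) Qv

glue-false : ∀ Q (f g : Fin n → Fin k) {v} → Q v ≡ false → glue Q f g v ≡ g v
glue-false Q f g {v} Qv = cong (λ x → if x then f v else g v) Qv

module _ {n k : ℕ} (G : Graph n) (P Q : Fin n → Bool) where
  open Graph G
  open Colouring {k = k} G

  -- `A` separates the palettes of the two parts, so edges between the parts are never
  -- monochromatic.
  glue-proper : ∀ {f g : Fin n → Fin k} (A : Fin k → Bool) →
    (∀ v → P v ≡ true → Q v ≡ true → A (f v) ≡ true) →
    (∀ v → P v ≡ true → Q v ≡ false → A (g v) ≡ false) →
    Proper (λ v → P v ∧ Q v) f → Proper (λ v → P v ∧ not (Q v)) g →
    Proper P (glue Q f g)
  glue-proper A f∈ g∉ f-prop g-prop u v Pu Pv uv with Q u in Qu | Q v in Qv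
  ... | true  | true  = f-prop u v (∧-intro Pu Qu) (∧-intro Pv Qv) uv
  ... | true  | false = λ eq → false≢true (g∉ v Pv Qv) (subst (λ X → A X ≡ true) eq (f∈ u Pu Qu))
  ... | false | true  = λ eq → false≢true (g∉ u Pu Qu) (subst (λ X → A X ≡ true) (sym eq) (f∈ v Pv Qv))
  ... | false | false = g-prop u v (∧-intro Pu (cong not Qu)) (∧-intro Pv (cong not Qv)) uv

-- From a nearly equitable to an equitable colouring

module NearlyEquitable {n k : ℕ} (G : Graph n) (P : Fin n → Bool) (C : Fin k → Bool) (s : ℕ)
  (degree : DegreeBelow G P (count C))
  (fewer-colours : ∀ P′ (C′ : Fin k → Bool) → count C′ < count C → count P′ ≡ count C′ * s →
                   DegreeBelow G P′ (count C′) → Equitable G P′ C′ s)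
  (a : Fin k) (Ca : C a ≡ true) where

  open Graph G
  open Colouring {k = k} G P

  -- The additive form covers `a` and `b` being equal, in which case every class already has size
  -- `s`.
  record Near (f : Fin n → Fin k) (b : Fin k) : Set where
    field
      colour∈ : ∀ v → P v ≡ true → C (f v) ≡ true
      proper  : Proper f
      large∈  : C b ≡ true
      sizes   : ∀ X → C X ≡ true → size f X + ⟦ a == X ⟧ ≡ s + ⟦ b == X ⟧

  inaccessible : (Fin n → Fin k) → Fin k → Bool
  inaccessible f X = C X ∧ not (Reach.set (reach f a C) X)

  shift-to-equitable : ∀ {f b} → Near f b → Reach.set (reach f a C) b ≡ true → Equitable G P C s
  shift-to-equitable {f} {b} near Ab with Reach.path (reach f a C) Ab
  ... | L , path , L⊆ = record
    { colour  = S.colour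
    ; colour∈ = λ v Pv → case S.local v of λ where
        (inj₁ eq) → trans (cong C eq) (N.colour∈ v Pv)
        (inj₂ (_ , c∈)) → Reach.within (reach f a C) (L⊆ c∈)
    ; proper  = S.proper
    ; sizes   = λ X CX → +-cancelʳ-≡ ⟦ b == X ⟧ _ _ (trans (S.sizes X) (N.sizes X CX))
    }
    where
    module N = Near near
    module S = Shifted (shift N.proper path)

  module Stuck {f b} (near : Near f b) (Ab : Reach.set (reach f a C) b ≡ false)
    (improve : ∀ {f′ b′} → Near f′ b′ → count (inaccessible f′) < count (inaccessible f) →
               Equitable G P C s) where

    open Near near
    open Reach (reach f a C) using () renaming (set to A; within to A⊆C)

    R : Fin k → Bool
    R = inaccessible f

    R⇒¬A : ∀ {X} → R X ≡ true → A X ≡ false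
    R⇒¬A = not-true ∘ ∧-elimʳ

    R-intro : ∀ {X} → C X ≡ true → A X ≡ false → R X ≡ true
    R-intro CX AX = ∧-intro CX (cong not AX)

    A≢ : ∀ {X Y} → A X ≡ true → A Y ≡ false → X ≢ Y
    A≢ AX AY refl = false≢true AY AX

    Aa : A a ≡ true
    Aa = Reach.root (reach f a C) Ca

    α β : ℕ
    α = count A
    β = count R

    α+β : α + β ≡ count C
    α+β = trans (cong (_+ β) (count-cong λ X → sym (absorb X))) (count-split C A)
      where
      absorb : ∀ X → C X ∧ A X ≡ A X
      absorb X with A X in AX
      ... | true  = ∧-intro (A⊆C AX) refl
      ... | false = Bool.∧-zeroʳ (C X)

    β<count : β < count C
    β<count = subst (β <_) α+β (m<n+m β (∃⇒count>0 a Aa))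

    B : Fin n → Bool
    B v = P v ∧ not (A (f v))

    dB : Fin n → ℕ
    dB v = count λ u → (P u ∧ adj v u) ∧ not (A (f u))

    -- The deficient class `a` is accessible and the large class `b` is not, so `B` carries the
    -- surplus and none of the deficit.
    count-B : count B ≡ suc (β * s)
    count-B = begin
      count B                                       ≡⟨ count-cong in-C ⟩
      count (λ v → P v ∧ R (f v))                   ≡⟨ count-fibres f P R ⟨
      sum (λ X → ⟦ R X ⟧ * size f X)                ≡⟨ sum-cong-≗ class ⟩
      sum (λ X → ⟦ R X ⟧ * s + ⟦ X == b ⟧ * 1)      ≡⟨ ∑-distrib-+ _ _ ⟩
      sum (λ X → ⟦ R X ⟧ * s) + sum (λ X → ⟦ X == b ⟧ * 1)
        ≡⟨ cong₂ _+_ (sum-weighted R s) (sum-singleton b 1) ⟩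
      β * s + 1                                     ≡⟨ +-comm (β * s) 1 ⟩
      suc (β * s)                                   ∎
      where
      open ≡-Reasoning
      in-C : ∀ v → B v ≡ P v ∧ R (f v)
      in-C v with P v in Pv
      ... | false = refl
      ... | true rewrite colour∈ v Pv = refl
      class : ∀ X → ⟦ R X ⟧ * size f X ≡ ⟦ R X ⟧ * s + ⟦ X == b ⟧ * 1
      class X with R X in RX | X ≟ b
      ... | false | no _ = refl
      ... | false | yes refl = false≢true RX (R-intro large∈ Ab)
      ... | true  | X≟b = begin
        size f X + 0              ≡⟨ cong (λ t → size f X + ⟦ t ⟧) (==-≢ (A≢ Aa (R⇒¬A RX))) ⟨
        size f X + ⟦ a == X ⟧     ≡⟨ sizes X (∧-elimˡ RX) ⟩
        s + ⟦ b == X ⟧            ≡⟨ cong₂ _+_ (sym (+-identityʳ s)) (flip X≟b) ⟩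
        s + 0 + ⟦ does X≟b ⟧ * 1  ∎
        where
        flip : ∀ X≟b → ⟦ b == X ⟧ ≡ ⟦ does X≟b ⟧ * 1
        flip (yes refl) rewrite ==-refl b = refl
        flip (no X≢b)   rewrite ==-≢ (X≢b ∘ sym) = refl

    size-A≤ : ∀ {X} → A X ≡ true → size f X ≤ s
    size-A≤ {X} AX = ≤-trans (m≤m+n _ ⟦ a == X ⟧) (≤-reflexive (trans (sizes X (A⊆C AX))
      (trans (cong (λ t → s + ⟦ t ⟧) (==-≢ (A≢ AX Ab ∘ sym))) (+-identityʳ s))))

    -- A vertex of `B` that is free for an accessible class would make its own class accessible.
    blocked : ∀ {y X} → B y ≡ true → A X ≡ true → 0 < nb f y X
    blocked {y} By AX = ¬Free⇒nb>0 λ free → false≢true (not-true (∧-elimʳ By))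
      (Reach.closed (reach f a C) (colour∈ y (∧-elimˡ By)) (∧-elimˡ By) refl AX free)

    -- The degree budget, shared between `B` and the accessible classes: whatever is known to go to
    -- the latter, recorded in `w`, is lost to `dB v`.
    degree-split : ∀ {v} → P v ≡ true → (w : Fin k → ℕ) →
      (∀ X → A X ≡ true → w X ≤ nb f v X) → dB v + sum (λ X → ⟦ A X ⟧ * w X) < α + β
    degree-split {v} Pv w w≤ = begin-strict
      dB v + sum (λ X → ⟦ A X ⟧ * w X)                     ≤⟨ +-monoʳ-≤ (dB v) (sum-mono λ X → ⟦⟧*-mono (w≤ X)) ⟩
      dB v + sum (λ X → ⟦ A X ⟧ * nb f v X)                ≡⟨ cong (dB v +_) (count-fibres f N A) ⟩
      dB v + count (λ u → N u ∧ A (f u))                   ≡⟨ +-comm (dB v) _ ⟩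
      count (λ u → N u ∧ A (f u)) + dB v                   ≡⟨ count-split N (A ∘ f) ⟩
      count N                                              <⟨ degree v Pv ⟩
      count C                                              ≡⟨ α+β ⟨
      α + β                                                ∎
      where
      open ≤-Reasoning
      N : Fin n → Bool
      N u = P u ∧ adj v u

    dB<β : ∀ {y} → B y ≡ true → dB y < β
    dB<β {y} By = +-cancelʳ-< α (dB y) β (subst₂ _<_
      (cong (dB y +_) (trans (sum-weighted A 1) (*-identityʳ α))) (+-comm α β)
      (degree-split (∧-elimˡ By) (λ _ → 1) (λ X → blocked By)))

    opaque
      -- Without `y` the size of `B` is exactly `β * s`, and `dB<β` is the degree bound for `β`
      -- colours. Hence only a place for `y` among the accessible classes remains to be found.
      recolour-B : ∀ {y} → B y ≡ true → Equitable G (λ v → B v ∧ not (v == y)) R s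
      recolour-B {y} By = fewer-colours _ R β<count
        (suc-injective (trans (sym (count-remove y By)) count-B))
        (λ v Bv → ≤-<-trans (count-mono (drop v)) (dB<β (∧-elimˡ Bv)))
        where
        drop : ∀ v u → (B u ∧ not (u == y)) ∧ adj v u ≡ true → (P u ∧ adj v u) ∧ not (A (f u)) ≡ true
        drop v u t = ∧-intro (∧-intro (∧-elimˡ {P u} (∧-elimˡ (∧-elimˡ t))) (∧-elimʳ t))
                             (∧-elimʳ {P u} (∧-elimˡ (∧-elimˡ t)))

    -- The weighted edges between `B` and the class `W`, summed from either end.
    double-count : ∀ W (g : Fin n → ℕ) →
      sum (λ y → ⟦ B y ⟧ * sum (λ z → ⟦ (P z ∧ adj y z) ∧ f z == W ⟧ * g z)) ≡
      sum (λ z → ⟦ P z ∧ f z == W ⟧ * (dB z * g z))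
    double-count W g = begin
      sum (λ y → ⟦ B y ⟧ * sum (λ z → ⟦ (P z ∧ adj y z) ∧ f z == W ⟧ * g z))
        ≡⟨ sum-cong-≗ (λ y → *-distribˡ-sum ⟦ B y ⟧ _) ⟩
      sum (λ y → sum (λ z → ⟦ B y ⟧ * (⟦ (P z ∧ adj y z) ∧ f z == W ⟧ * g z)))
        ≡⟨ ∑-comm _ ⟩
      sum (λ z → sum (λ y → ⟦ B y ⟧ * (⟦ (P z ∧ adj y z) ∧ f z == W ⟧ * g z)))
        ≡⟨ sum-cong-≗ (λ z → sum-cong-≗ (λ y → turn y z)) ⟩
      sum (λ z → sum (λ y → ⟦ P z ∧ f z == W ⟧ * g z * ⟦ (P y ∧ adj z y) ∧ not (A (f y)) ⟧))
        ≡⟨ sum-cong-≗ (λ z → *-distribˡ-sum (⟦ P z ∧ f z == W ⟧ * g z) _) ⟨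
      sum (λ z → ⟦ P z ∧ f z == W ⟧ * g z * dB z)
        ≡⟨ sum-cong-≗ (λ z → trans (*-assoc ⟦ P z ∧ f z == W ⟧ (g z) (dB z))
                                   (cong (⟦ P z ∧ f z == W ⟧ *_) (*-comm (g z) (dB z)))) ⟩
      sum (λ z → ⟦ P z ∧ f z == W ⟧ * (dB z * g z)) ∎
      where
      open ≡-Reasoning
      shuffle : ∀ py na pz e w g → py * na * (pz * e * w * g) ≡ pz * w * g * (py * e * na)
      shuffle = solve-∀
      turn : ∀ y z → ⟦ B y ⟧ * (⟦ (P z ∧ adj y z) ∧ f z == W ⟧ * g z)
                   ≡ ⟦ P z ∧ f z == W ⟧ * g z * ⟦ (P y ∧ adj z y) ∧ not (A (f y)) ⟧
      turn y z rewrite ⟦∧⟧ (P y) (not (A (f y))) | ⟦∧⟧ (P z ∧ adj y z) (f z == W) | ⟦∧⟧ (P z) (adj y z)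
                     | ⟦∧⟧ (P z) (f z == W) | ⟦∧⟧ (P y ∧ adj z y) (not (A (f y))) | ⟦∧⟧ (P y) (adj z y)
                     | adj-sym z y =
        shuffle ⟦ P y ⟧ ⟦ not (A (f y)) ⟧ ⟦ P z ⟧ ⟦ adj y z ⟧ ⟦ f z == W ⟧ (g z)

    -- |B| = βs + 1 is too large for a class of s vertices to supply weight c to each
    -- member of B when no vertex of the class supplies more than cβ in total.
    overcount : ∀ {W} → A W ≡ true → ∀ c (g : Fin n → ℕ) →
      (∀ y → B y ≡ true → suc c ≤ sum (λ z → ⟦ (P z ∧ adj y z) ∧ f z == W ⟧ * g z)) →
      ¬ (∀ z → P z ≡ true → f z ≡ W → dB z * g z ≤ suc c * β)
    overcount {W} AW c g supply demand = 1+n≰n (≤-trans (m≤m+n _ c) (begin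
      suc (suc c * (s * β)) + c                      ≡⟨ arrange c s β ⟩
      suc (β * s) * suc c                            ≡⟨ cong (_* suc c) count-B ⟨
      count B * suc c                                ≡⟨ sum-weighted B (suc c) ⟨
      sum (λ y → ⟦ B y ⟧ * suc c)                    ≤⟨ sum-mono (λ y → ⟦⟧*-mono (supply y)) ⟩
      sum (λ y → ⟦ B y ⟧ * sum (λ z → ⟦ (P z ∧ adj y z) ∧ f z == W ⟧ * g z))
                                                     ≡⟨ double-count W g ⟩
      sum (λ z → ⟦ P z ∧ f z == W ⟧ * (dB z * g z))  ≤⟨ sum-mono (λ z → ⟦⟧*-mono (λ t →
                                                          demand z (∧-elimˡ t) (==⇒≡ (∧-elimʳ {P z} t)))) ⟩
      sum (λ z → ⟦ P z ∧ f z == W ⟧ * (suc c * β))   ≡⟨ sum-weighted (λ z → P z ∧ f z == W) (suc c * β) ⟩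
      size f W * (suc c * β)                         ≤⟨ *-monoˡ-≤ (suc c * β) (size-A≤ AW) ⟩
      s * (suc c * β)                                ≡⟨ regroup s c β ⟩
      suc c * (s * β)                                ∎))
      where
      open ≤-Reasoning
      arrange : ∀ c s β → suc (suc c * (s * β)) + c ≡ suc (β * s) * suc c
      arrange = solve-∀
      regroup : ∀ s c β → s * (suc c * β) ≡ suc c * (s * β)
      regroup = solve-∀

    -- Terminal classes

    avoiding : Fin k → Fin k → Bool
    avoiding W X = C X ∧ not (X == W)

    avoiding⇒≢ : ∀ {W X} → avoiding W X ≡ true → X ≢ W
    avoiding⇒≢ {W} t refl = false≢true (cong not (==-refl W)) (∧-elimʳ {C W} t)

    avoiding-intro : ∀ {W X} → C X ≡ true → X ≢ W → avoiding W X ≡ true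
    avoiding-intro CX X≢W = ∧-intro CX (cong not (==-≢ X≢W))

    -- The accessible classes that reach a without passing through W, and those that do not.
    free-of : ∀ W → Reach f a (avoiding W)
    free-of W = reach f a (avoiding W)

    S : Fin k → Fin k → Bool
    S W = Reach.set (free-of W)

    T : Fin k → Fin k → Bool
    T W X = A X ∧ not (X == W) ∧ not (S W X)

    T⇒A : ∀ {W X} → T W X ≡ true → A X ≡ true
    T⇒A = ∧-elimˡ

    T⇒≢ : ∀ {W X} → T W X ≡ true → X ≢ W
    T⇒≢ {W} {X} t refl = false≢true (cong not (==-refl W)) (∧-elimˡ (∧-elimʳ {A W} t))

    T⇒¬S : ∀ {W X} → T W X ≡ true → S W X ≡ false
    T⇒¬S {W} {X} t = not-true (∧-elimʳ {not (X == W)} (∧-elimʳ {A X} t))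

    T-intro : ∀ {W X} → A X ≡ true → X ≢ W → S W X ≡ false → T W X ≡ true
    T-intro AX X≢W SX = ∧-intro AX (∧-intro (cong not (==-≢ X≢W)) (cong not SX))

    S⇒A : ∀ {W X} → S W X ≡ true → A X ≡ true
    S⇒A {W} SX with Reach.path (free-of W) SX
    ... | L , path , L⊆ = Reach.complete (reach f a C) path (∧-elimˡ ∘ Reach.within (free-of W) ∘ L⊆)

    S⇒≢ : ∀ {W X} → S W X ≡ true → X ≢ W
    S⇒≢ {W} = avoiding⇒≢ ∘ Reach.within (free-of W)

    -- Forbidding `W` cuts no other accessible class off from `a`, so the content of `W` may be
    -- disturbed safely.
    Terminal : Fin k → Set
    Terminal W = ∀ {X} → A X ≡ true → X ≢ W → S W X ≡ true

    -- All classes of a path from `X` to `a` around `U` lie in `S U`, whereas `W` does not, so the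
    -- path avoids `W` too.
    S-descends : ∀ {U W X} → T U W ≡ true → S U X ≡ true → S W X ≡ true
    S-descends {U} {W} TW SX with Reach.path (free-of U) SX
    ... | L , path , L⊆ = Reach.complete (free-of W) path λ Y∈ →
      avoiding-intro (A⊆C (S⇒A (L⊆ Y∈))) λ { refl → false≢true (T⇒¬S TW) (L⊆ Y∈) }

    path-tail⊆S : ∀ {U X L} → Path f a X L → U ∉ L → (∀ {Y} → Y ∈ L → A Y ≡ true) →
                  ∀ {Y} → Y ∈ L → S U Y ≡ true
    path-tail⊆S done U∉ L⊆A ()
    path-tail⊆S {U} (step {Y = Z} {L} _ _ _ _ _ path) U∉ L⊆A (here refl) =
      Reach.complete (free-of U) path λ {Y} Y∈ → avoiding-intro (A⊆C (L⊆A Y∈)) λ { refl → U∉ Y∈ }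
    path-tail⊆S (step _ _ _ _ _ path) U∉ L⊆A (there Y∈) =
      path-tail⊆S path (U∉ ∘ there) (L⊆A ∘ there) Y∈

    -- On a simple path from `U` to `a`, every class after `U` reaches `a` around `U`; hence `W`,
    -- which does not, is not on the path.
    S-contains : ∀ {U W} → A U ≡ true → T U W ≡ true → S W U ≡ true
    S-contains {U} {W} AU TW with Reach.path (reach f a C) AU
    ... | L , path , L⊆ = Reach.complete (free-of W) path λ
      { (here refl) → avoiding-intro (A⊆C AU) (T⇒≢ TW ∘ sym)
      ; (there Y∈)  → avoiding-intro (A⊆C (L⊆ (there Y∈))) λ { refl →
          false≢true (T⇒¬S TW) (path-tail⊆S path (path-simple path) (L⊆ ∘ there) Y∈) } }

    record TerminalFamily : Set where
      field
        U        : Fin k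
        AU       : A U ≡ true
        inhabited : ∃ λ W → T U W ≡ true
        terminal : ∀ {W} → T U W ≡ true → Terminal W

    -- When T U is non-empty and minimal, every class in it is terminal.
    terminal-family : ∀ U → A U ≡ true → (∃ λ W → T U W ≡ true) → TerminalFamily
    terminal-family U AU ex = go U AU ex (<-wellFounded _)
      where
      go : ∀ U → A U ≡ true → (∃ λ W → T U W ≡ true) → Acc _<_ (count (T U)) → TerminalFamily
      go U AU ex (acc rec)
        with Fin.any? (λ W → (T U W Bool.≟ true) ×-dec Fin.any? (λ X → T W X Bool.≟ true))
      -- A class of `T W` is neither `U` nor in `S U`, as these reach `a` around `W`. So `T W` lies
      -- in `T U`, strictly because it lacks `W`.
      ... | yes (W , TW , X , TX) = go W (T⇒A TW) (X , TX) (rec (count-strict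
              (λ Y TY → T-intro (T⇒A TY)
                 (λ { refl → false≢true (T⇒¬S TY) (S-contains AU TW) })
                 (Bool.¬-not λ SY → false≢true (T⇒¬S TY) (S-descends TW SY)))
              W TW (Bool.¬-not λ TWW → T⇒≢ TWW refl)))
      ... | no ∄ = record
        { U = U ; AU = AU ; inhabited = ex
        ; terminal = λ {W} TW {X} AX X≢W → Bool.¬-not λ SX → ∄ (W , TW , X , T-intro AX X≢W SX) }

    -- Every path ends in `a`, so `S a` is empty and `T a` consists of all accessible classes but
    -- `a`. If there were none, each vertex of the class `a` would have at most `β` neighbours in
    -- `B`, too few for every vertex of `B` to have a neighbour in `a`.
    T-a-inhabited : ∃ λ W → T a W ≡ true
    T-a-inhabited with Fin.any? (λ W → T a W Bool.≟ true)
    ... | yes ex = ex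
    ... | no ∄ = ⊥-elim (overcount Aa 0 (λ _ → 1) supply demand)
      where
      A⊆a : ∀ X → A X ≡ X == a
      A⊆a X with X ≟ a
      ... | yes refl = Aa
      ... | no X≢a = Bool.¬-not λ AX → ∄ (X , T-intro AX X≢a
              (Bool.¬-not λ SX → S⇒≢ (Reach.root∈ (free-of a) SX) refl))
      α≡1 : α ≡ 1
      α≡1 = trans (count-cong A⊆a) (count-singleton a)
      supply : ∀ y → B y ≡ true → 1 ≤ sum (λ z → ⟦ (P z ∧ adj y z) ∧ f z == a ⟧ * 1)
      supply y By = ≤-trans (blocked By Aa) (sum-mono λ z → ≤-reflexive (sym (*-identityʳ _)))
      demand : ∀ z → P z ≡ true → f z ≡ a → dB z * 1 ≤ 1 * β
      demand z Pz _ = subst₂ _≤_ (sym (*-identityʳ (dB z))) (sym (+-identityʳ β))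
        (s≤s⁻¹ (subst (dB z <_) (cong (_+ β) α≡1) (≤-<-trans (m≤m+n (dB z) _)
          (degree-split Pz (λ _ → 0) (λ _ _ → z≤n)))))

    -- Solo edges and the two ways of using them

    module Terminals (family : TerminalFamily) where
      open TerminalFamily family

      t : ℕ
      t = count (T U)

      -- The solo edges of Kierstead and Kostochka: z is the only neighbour of y in its class.
      solo : Fin n → Fin n → Bool
      solo y z = (P z ∧ adj y z) ∧ (T U (f z) ∧ (nb f y (f z) ≡ᵇ 1))

      solo-P : ∀ {y z} → solo y z ≡ true → P z ≡ true
      solo-P = ∧-elimˡ ∘ ∧-elimˡ

      solo-adj : ∀ {y z} → solo y z ≡ true → adj y z ≡ true
      solo-adj {y} {z} = ∧-elimʳ {P z} ∘ ∧-elimˡ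

      solo-T : ∀ {y z} → solo y z ≡ true → T U (f z) ≡ true
      solo-T {y} {z} sol = ∧-elimˡ (∧-elimʳ {P z ∧ adj y z} sol)

      ≡ᵇ1⇒≡ : ∀ m → (m ≡ᵇ 1) ≡ true → m ≡ 1
      ≡ᵇ1⇒≡ 1 _ = refl

      solo-unique : ∀ {y z v} → solo y z ≡ true → P v ≡ true → adj y v ≡ true → f v ≡ f z → v ≡ z
      solo-unique {y} {z} {v} sol Pv yv fv = count≡1⇒unique
        (≡ᵇ1⇒≡ _ (∧-elimʳ {T U (f z)} (∧-elimʳ {P z ∧ adj y z} sol)))
        (∧-intro (∧-elimˡ sol) (==-refl (f z)))
        (∧-intro (∧-intro Pv yv) (subst (λ X → f v == X ≡ true) fv (==-refl (f v))))

      -- Each of the `α` accessible classes contains a neighbour of `y`, and each class of `T U`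
      -- where that neighbour is not unique contains a second one. The rest of the degree budget
      -- bounds `dB y`.
      solo-count : ∀ {y} → B y ≡ true → t + suc (dB y) ≤ β + count (solo y)
      solo-count {y} By = +-cancelˡ-≤ α _ _ (begin
        α + (t + suc (dB y))                                     ≡⟨ cong (λ m → α + (m + suc (dB y))) split-T ⟨
        α + (single + multiple + suc (dB y))                     ≡⟨ arrange α single multiple (dB y) ⟩
        single + suc (dB y + (α + multiple))                     ≡⟨ cong (λ m → single + suc (dB y + m)) weights ⟨
        single + suc (dB y + sum (λ X → ⟦ A X ⟧ * w X))          ≤⟨ +-monoʳ-≤ single (degree-split (∧-elimˡ By) w w≤) ⟩
        single + (α + β)                                         ≡⟨ regroup single α β ⟩
        α + (β + single)                                         ≡⟨ cong (λ m → α + (β + m)) solo≡single ⟨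
        α + (β + count (solo y))                                 ∎)
        where
        open ≤-Reasoning
        one : Fin k → Bool
        one X = nb f y X ≡ᵇ 1
        single multiple : ℕ
        single   = count λ X → T U X ∧ one X
        multiple = count λ X → T U X ∧ not (one X)
        split-T : single + multiple ≡ t
        split-T = count-split (T U) one
        w : Fin k → ℕ
        w X = 1 + ⟦ T U X ∧ not (one X) ⟧
        w≤ : ∀ X → A X ≡ true → w X ≤ nb f y X
        w≤ X AX with nb f y X | blocked By AX
        ... | suc zero    | _ rewrite Bool.∧-zeroʳ (T U X) = ≤-refl
        ... | suc (suc m) | _ = s≤s (≤-trans (⟦⟧≤1 _) (s≤s z≤n))
        A-T : ∀ X → ⟦ A X ⟧ * w X ≡ ⟦ A X ⟧ + ⟦ T U X ∧ not (one X) ⟧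
        A-T X with A X
        ... | true  = +-identityʳ _
        ... | false = refl
        weights : sum (λ X → ⟦ A X ⟧ * w X) ≡ α + multiple
        weights = trans (sum-cong-≗ A-T) (∑-distrib-+ _ _)
        solo≡single : count (solo y) ≡ single
        solo≡single = trans (sym (count-fibres f (λ z → P z ∧ adj y z) (λ X → T U X ∧ one X)))
                            (sum-cong-≗ value)
          where
          value : ∀ X → ⟦ T U X ∧ one X ⟧ * nb f y X ≡ ⟦ T U X ∧ one X ⟧
          value X with T U X | nb f y X
          ... | false | _ = refl
          ... | true  | zero = refl
          ... | true  | suc zero = refl
          ... | true  | suc (suc _) = refl
        arrange : ∀ α σ μ d → α + (σ + μ + suc d) ≡ σ + suc (d + (α + μ))
        arrange = solve-∀
        regroup : ∀ σ α β → σ + (α + β) ≡ α + (β + σ)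
        regroup = solve-∀

      split-A : count (S U) + suc t ≡ α
      split-A = begin
        count (S U) + suc t                                      ≡⟨ cong (λ m → count (S U) + (m + t)) (sum-singleton U 1) ⟨
        count (S U) + (sum (λ X → ⟦ X == U ⟧ * 1) + t)           ≡⟨ cong (count (S U) +_) (∑-distrib-+ _ _) ⟨
        count (S U) + sum (λ X → ⟦ X == U ⟧ * 1 + ⟦ T U X ⟧)     ≡⟨ ∑-distrib-+ _ _ ⟨
        sum (λ X → ⟦ S U X ⟧ + (⟦ X == U ⟧ * 1 + ⟦ T U X ⟧))     ≡⟨ sum-cong-≗ pieces ⟩
        α                                                        ∎
        where
        open ≡-Reasoning
        pieces : ∀ X → ⟦ S U X ⟧ + (⟦ X == U ⟧ * 1 + ⟦ T U X ⟧) ≡ ⟦ A X ⟧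
        pieces X with X ≟ U
        pieces X | yes refl with S U U in SU
        ... | true = contradiction refl (S⇒≢ SU)
        ... | false rewrite AU = refl
        pieces X | no X≢U with S U X in SX
        ... | true rewrite S⇒A SX = refl
        ... | false = cong ⟦_⟧ (Bool.∧-identityʳ (A X))

      -- `z` has a neighbour in each class of `S U`, as otherwise its own class would reach `a`
      -- around `U`. By `split-A` this uses up `α - t - 1` of at most `α + β - 1` neighbours.
      dB-terminal : ∀ {z} → P z ≡ true → T U (f z) ≡ true → dB z ≤ β + t
      dB-terminal {z} Pz Tz = s≤s⁻¹ (+-cancelʳ-< (count (S U)) _ _ (begin-strict
        dB z + count (S U)                       ≡⟨ cong (dB z +_) (sum-cong-≗ in-A) ⟨
        dB z + sum (λ X → ⟦ A X ⟧ * ⟦ S U X ⟧)   <⟨ degree-split Pz (⟦_⟧ ∘ S U) (λ X _ → S-blocked X) ⟩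
        α + β                                    ≡⟨ cong (_+ β) split-A ⟨
        count (S U) + suc t + β                  ≡⟨ arrange (count (S U)) t β ⟩
        suc (β + t) + count (S U)                ∎))
        where
        open ≤-Reasoning
        arrange : ∀ σ t β → σ + suc t + β ≡ suc (β + t) + σ
        arrange = solve-∀
        in-A : ∀ X → ⟦ A X ⟧ * ⟦ S U X ⟧ ≡ ⟦ S U X ⟧
        in-A X with S U X in SX
        ... | false = *-zeroʳ ⟦ A X ⟧
        ... | true rewrite S⇒A SX = refl
        S-blocked : ∀ X → ⟦ S U X ⟧ ≤ nb f z X
        S-blocked X with S U X in SX
        ... | false = z≤n
        ... | true  = ¬Free⇒nb>0 λ free → false≢true (T⇒¬S Tz)
                (Reach.closed (free-of U) (avoiding-intro (colour∈ z Pz) (T⇒≢ Tz)) Pz refl SX free)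

      Immovable : Fin n → Set
      Immovable z = ∀ {X} → A X ≡ true → X ≢ f z → ¬ Free f z X

      -- A neighbour in each of the other `α - 1` accessible classes leaves at most `β` of the
      -- degree.
      dB-immovable : ∀ {z} → P z ≡ true → A (f z) ≡ true → Immovable z → dB z ≤ β
      dB-immovable {z} Pz Az imm = s≤s⁻¹ (+-cancelʳ-< others _ _ (begin-strict
        dB z + others                                        ≡⟨ cong (dB z +_) (sum-cong-≗ λ X → ⟦∧⟧ (A X) _) ⟩
        dB z + sum (λ X → ⟦ A X ⟧ * ⟦ not (X == f z) ⟧)      <⟨ degree-split Pz _ blocked′ ⟩
        α + β                                                ≡⟨ cong (_+ β) (count-remove (f z) Az) ⟩
        suc others + β                                       ≡⟨ cong suc (+-comm others β) ⟩
        suc β + others                                       ∎))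
        where
        open ≤-Reasoning
        others : ℕ
        others = count λ X → A X ∧ not (X == f z)
        blocked′ : ∀ X → A X ≡ true → ⟦ not (X == f z) ⟧ ≤ nb f z X
        blocked′ X AX with X ≟ f z
        ... | yes _   = z≤n
        ... | no X≢fz = ¬Free⇒nb>0 (imm AX X≢fz)

      -- A movable solo vertex z makes room for its solo neighbour y in the class of z.
      replace-movable : ∀ {y z X} → B y ≡ true → solo y z ≡ true → A X ≡ true → X ≢ f z → Free f z X →
                        Equitable G P C s
      replace-movable {y} {z} {X} By sol AX X≢W free = record
        { colour  = c
        ; colour∈ = c∈C
        ; proper  = glue-proper G P Q A (λ v _ → p∈A v) (λ v Pv Qv → R⇒¬A (h∈R v Pv Qv))
                      p-proper (λ u v u∈ v∈ → H.proper u v (rest u u∈) (rest v v∈))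
        ; sizes   = c-sizes
        }
        where
        W = f z
        AW : A W ≡ true
        AW = T⇒A (solo-T {y} sol)
        Ay : A (f y) ≡ false
        Ay = not-true (∧-elimʳ {P y} By)
        -- `W` is terminal, so `X` reaches `a` with `W` forbidden, and the path from `W` through `X`
        -- is simple.
        path-X : ∃ λ L → Path f a X L × (∀ {Y} → Y ∈ X ∷ L → S W Y ≡ true)
        path-X = Reach.path (free-of W) (terminal (solo-T {y} sol) AX X≢W)
        L = proj₁ path-X
        path = proj₁ (proj₂ path-X)
        W∉ : W ∉ X ∷ L
        W∉ W∈ = S⇒≢ (proj₂ (proj₂ path-X) W∈) refl
        L⊆A : ∀ {Y} → Y ∈ W ∷ X ∷ L → A Y ≡ true
        L⊆A (here refl) = AW
        L⊆A (there Y∈) = S⇒A (proj₂ (proj₂ path-X) Y∈)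
        shifted : Shifted f a W (X ∷ L)
        shifted = shift proper (step z (solo-P {y} sol) refl free W∉ path)
        module G′ = Shifted shifted
        g = G′.colour
        g∈A : ∀ v → A (f v) ≡ true → A (g v) ≡ true
        g∈A v Av with G′.local v
        ... | inj₁ eq = trans (cong A eq) Av
        ... | inj₂ (_ , g∈) = L⊆A g∈
        g-fixed : ∀ v → A (f v) ≡ false → A (g v) ≡ false
        g-fixed v Av with G′.local v
        ... | inj₁ eq = trans (cong A eq) Av
        ... | inj₂ (f∈ , _) = false≢true Av (L⊆A f∈)
        module H = Equitable (recolour-B By)
        h = H.colour
        Q : Fin n → Bool
        -- The accessible vertices after the shift, together with `y`, keep the palette `A`; the
        -- rest of `B` is coloured afresh from `R`.
        Q = insert y (A ∘ f)
        p = recolour g y W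
        c = glue Q p h
        p∈A : ∀ v → Q v ≡ true → A (p v) ≡ true
        p∈A v Qv with v ≟ y
        ... | yes _ = AW
        ... | no _ = g∈A v Qv
        rest : ∀ v → P v ∧ not (Q v) ≡ true → B v ∧ not (v == y) ≡ true
        rest v t with v ≟ y
        ... | yes refl = false≢true (Bool.∧-zeroʳ (P v)) t
        ... | no _ = ∧-intro t refl
        h∈R : ∀ v → P v ≡ true → Q v ≡ false → R (h v) ≡ true
        h∈R v Pv Qv = H.colour∈ v (rest v (∧-intro Pv (cong not Qv)))
        c∈C : ∀ v → P v ≡ true → C (c v) ≡ true
        c∈C v Pv with Q v in Qv
        ... | true = A⊆C (p∈A v Qv)
        ... | false = ∧-elimˡ (h∈R v Pv Qv)
        p-proper : Colouring.Proper G (λ v → P v ∧ Q v) p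
        -- The shift has removed `z`, the only neighbour of `y` in `W`, and has brought nothing into
        -- `W`.
        p-proper = Colouring.recolour-proper G (λ v → P v ∧ Q v)
          (λ u v _ _ u∈ v∈ → G′.proper u v (∧-elimˡ u∈) (∧-elimˡ v∈))
          (λ v v∈ yv gv → case shift-head proper (solo-P {y} sol) refl free W∉ path v gv of λ
             (fv , v≢z) → v≢z (solo-unique sol (∧-elimˡ v∈) yv fv))
        c-sizes : ∀ Z → C Z ≡ true → size c Z ≡ s
        c-sizes Z CZ with A Z in AZ
        ... | true = begin
          size c Z               ≡⟨ count-extend y (W == Z) from-g ⟩
          size g Z + ⟦ W == Z ⟧  ≡⟨ G′.sizes Z ⟩
          size f Z + ⟦ a == Z ⟧  ≡⟨ sizes Z CZ ⟩
          s + ⟦ b == Z ⟧         ≡⟨ cong (λ x → s + ⟦ x ⟧) (==-≢ (A≢ AZ Ab ∘ sym)) ⟩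
          s + 0                  ≡⟨ +-identityʳ s ⟩
          s                      ∎
          where
          open ≡-Reasoning
          from-g : ∀ v → ⟦ P v ∧ c v == Z ⟧ ≡ ⟦ P v ∧ g v == Z ⟧ + ⟦ v == y ⟧ * ⟦ W == Z ⟧
          from-g v with P v in Pv
          from-g v | false with v ≟ y
          ... | yes refl = false≢true Pv (∧-elimˡ By)
          ... | no _ = refl
          from-g v | true with v ≟ y
          ... | yes refl rewrite ==-≢ (A≢ AZ (g-fixed v Ay) ∘ sym) = sym (+-identityʳ _)
          ... | no v≢y with A (f v) in Av
          ...   | true = sym (+-identityʳ _)
          ...   | false rewrite ==-≢ (A≢ AZ (g-fixed v Av) ∘ sym)
                  | ==-≢ (A≢ AZ (R⇒¬A (H.colour∈ v (∧-intro (∧-intro Pv (cong not Av)) (cong not (==-≢ v≢y))))) ∘ sym)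
                  = refl
        ... | false = trans (count-cong from-h) (H.sizes Z (R-intro CZ AZ))
          where
          from-h : ∀ v → P v ∧ c v == Z ≡ (B v ∧ not (v == y)) ∧ h v == Z
          from-h v with P v
          ... | false = refl
          ... | true with v ≟ y
          ...   | yes refl rewrite Ay | ==-≢ (A≢ AW AZ) = refl
          ...   | no _ with A (f v) in Av
          ...     | true  = ==-≢ (A≢ (g∈A v Av) AZ)
          ...     | false = refl

      -- An immovable solo vertex z with two non-adjacent solo neighbours moves to an inaccessible
      -- class and y₁ takes its place; then the class of y₂ becomes accessible.
      swap-into : ∀ {y₁ y₂ z} → B y₁ ≡ true → B y₂ ≡ true → y₁ ≢ y₂ → adj y₁ y₂ ≡ false →
                  solo y₁ z ≡ true → solo y₂ z ≡ true → Immovable z →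
                  (H : Equitable G (λ v → B v ∧ not (v == y₁)) R s) → ∀ X → R X ≡ true →
                  (∀ v → B v ∧ not (v == y₁) ≡ true → adj z v ≡ true → Equitable.colour H v ≢ X) →
                  Equitable G P C s
      swap-into {y₁} {y₂} {z} B₁ B₂ y₁≢y₂ y₁y₂ sol₁ sol₂ imm H X RX X-free =
        -- `X` receives `z` on top of its `s` vertices and is the new large class; `h y₂` is the
        -- class that becomes accessible.
        improve {c} {X} c-near (count-strict shrink (h y₂) (h∈R y₂ B⁻y₂) newly)
        where
        W = f z
        Pz : P z ≡ true
        Pz = solo-P {y₁} sol₁
        AW : A W ≡ true
        AW = T⇒A (solo-T {y₁} sol₁)
        A₁ : A (f y₁) ≡ false
        A₁ = not-true (∧-elimʳ {P y₁} B₁)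
        P₁ : P y₁ ≡ true
        P₁ = ∧-elimˡ B₁
        z≢y₁ : z ≢ y₁
        z≢y₁ refl = false≢true A₁ AW
        B⁻ : Fin n → Bool
        B⁻ v = B v ∧ not (v == y₁)
        module H = Equitable H
        h = H.colour
        h∈R : ∀ v → B⁻ v ≡ true → R (h v) ≡ true
        h∈R = H.colour∈
        AX : A X ≡ false
        AX = R⇒¬A RX
        keep Q : Fin n → Bool
        keep v = A (f v) ∧ not (v == z)
        Q = insert y₁ keep
        p = recolour f y₁ W
        q = recolour h z X
        c = glue Q p q
        p∈A : ∀ v → Q v ≡ true → A (p v) ≡ true
        p∈A v Qv with v ≟ y₁
        ... | yes _ = AW
        ... | no _ = ∧-elimˡ Qv
        rest : ∀ v → P v ∧ not (Q v) ≡ true → v ≢ z → B⁻ v ≡ true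
        rest v x v≢z with v ≟ y₁
        ... | yes refl = false≢true (Bool.∧-zeroʳ (P v)) x
        ... | no _ rewrite ==-≢ v≢z | Bool.∧-identityʳ (A (f v)) = ∧-intro x refl
        q∈R : ∀ v → P v ≡ true → Q v ≡ false → R (q v) ≡ true
        q∈R v Pv Qv = by-cases (v ≟ z)
          where
          by-cases : Dec (v ≡ z) → R (q v) ≡ true
          by-cases (yes refl) = trans (cong R (recolour-same h z X)) RX
          by-cases (no v≢z)   = trans (cong R (recolour-other h z X v≢z))
                                      (h∈R v (rest v (∧-intro Pv (cong not Qv)) v≢z))
        p-proper : Colouring.Proper G (λ v → P v ∧ Q v) p
        p-proper = Colouring.recolour-proper G (λ v → P v ∧ Q v)
          (λ u v _ _ u∈ v∈ → proper u v (∧-elimˡ u∈) (∧-elimˡ v∈))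
          (λ v v∈ y₁v fv → case solo-unique sol₁ (∧-elimˡ v∈) y₁v fv of λ { refl → z∉Q (∧-elimʳ {P v} v∈) })
          where
          z∉Q : ¬ (Q z ≡ true)
          z∉Q = insert-elim y₁ keep (λ { refl → false≢true A₁ AW })
                            λ x → false≢true (cong not (==-refl z)) (∧-elimʳ {A (f z)} x)
        q-proper : Colouring.Proper G (λ v → P v ∧ not (Q v)) q
        q-proper = Colouring.recolour-proper G (λ v → P v ∧ not (Q v))
          (λ u v u≢z v≢z u∈ v∈ → H.proper u v (rest u u∈ u≢z) (rest v v∈ v≢z))
          (λ v v∈ zv → X-free v (rest v v∈ λ { refl → false≢true (adj-irr z) zv }) zv)

        -- The four regions on which `c` has a simple value; sizes and accessibility are checked
        -- region by region instead of through the nested conditionals in `c`.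
        data Kind (v : Fin n) : Set where
          is-z  : v ≡ z → c v ≡ X → Kind v
          is-y₁ : v ≡ y₁ → c v ≡ W → Kind v
          in-A  : v ≢ z → v ≢ y₁ → A (f v) ≡ true → c v ≡ f v → Kind v
          in-B  : v ≢ z → v ≢ y₁ → A (f v) ≡ false → c v ≡ h v → Kind v

        kind : ∀ v → Kind v
        kind v = by-cases (v ≟ y₁) (v ≟ z)
          where
          by-cases : Dec (v ≡ y₁) → Dec (v ≡ z) → Kind v
          by-cases (yes refl) _ =
            is-y₁ refl (trans (glue-true Q p q (insert-here y₁ keep)) (recolour-same f y₁ W))
          by-cases (no v≢y₁) (yes refl) = is-z refl (trans
            (glue-false Q p q (insert-∉ keep v≢y₁
              (trans (cong (λ x → A (f z) ∧ not x) (==-refl z)) (Bool.∧-zeroʳ (A (f z))))))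
            (recolour-same h z X))
          by-cases (no v≢y₁) (no v≢z) = by-A (A (f v)) refl
            where
            by-A : ∀ x → A (f v) ≡ x → Kind v
            by-A true Av = in-A v≢z v≢y₁ Av (trans
              (glue-true Q p q (insert-there y₁ keep (∧-intro Av (cong not (==-≢ v≢z)))))
              (recolour-other f y₁ W v≢y₁))
            by-A false Av = in-B v≢z v≢y₁ Av (trans
              (glue-false Q p q (insert-∉ keep v≢y₁ (cong (_∧ not (v == z)) Av)))
              (recolour-other h z X v≢z))

        B⁻-intro : ∀ {v} → P v ≡ true → v ≢ y₁ → A (f v) ≡ false → B⁻ v ≡ true
        B⁻-intro Pv v≢y₁ Av = ∧-intro (∧-intro Pv (cong not Av)) (cong not (==-≢ v≢y₁))
        ¬A-h : ∀ {v} → P v ≡ true → v ≢ y₁ → A (f v) ≡ false → A (h v) ≡ false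
        ¬A-h Pv v≢y₁ Av = R⇒¬A (h∈R _ (B⁻-intro Pv v≢y₁ Av))

        B⁻⇒¬A : ∀ {v} → B⁻ v ≡ true → A (f v) ≡ false
        B⁻⇒¬A {v} B⁻v = not-true (∧-elimʳ {P v} (∧-elimˡ B⁻v))
        B⁻≡P : ∀ {v} → v ≢ y₁ → A (f v) ≡ false → B⁻ v ≡ P v
        B⁻≡P {v} v≢y₁ Av = trans (cong₂ _∧_ (cong (λ x → P v ∧ not x) Av) (cong not (==-≢ v≢y₁)))
          (trans (Bool.∧-identityʳ (P v ∧ true)) (Bool.∧-identityʳ (P v)))

        c-near : Near c X
        c-near = record
          { colour∈ = c∈C
          ; proper  = glue-proper G P Q A (λ v _ → p∈A v) (λ v Pv Qv → R⇒¬A (q∈R v Pv Qv)) p-proper q-proper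
          ; large∈  = ∧-elimˡ RX
          ; sizes   = c-sizes
          }
          where
          c∈C : ∀ v → P v ≡ true → C (c v) ≡ true
          c∈C v Pv with Q v in Qv
          ... | true  = A⊆C (p∈A v Qv)
          ... | false = ∧-elimˡ (q∈R v Pv Qv)
          c-sizes : ∀ Y → C Y ≡ true → size c Y + ⟦ a == Y ⟧ ≡ s + ⟦ X == Y ⟧
          c-sizes Y CY = by-cases (A Y) refl
            where
            by-cases : ∀ x → A Y ≡ x → size c Y + ⟦ a == Y ⟧ ≡ s + ⟦ X == Y ⟧
            by-cases true AY = begin
              size c Y + ⟦ a == Y ⟧  ≡⟨ cong (_+ ⟦ a == Y ⟧) (+-cancelʳ-≡ ⟦ W == Y ⟧ _ _
                                          (count-exchange z y₁ (W == Y) (W == Y) swapped)) ⟩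
              size f Y + ⟦ a == Y ⟧  ≡⟨ sizes Y CY ⟩
              s + ⟦ b == Y ⟧         ≡⟨ cong (λ x → s + ⟦ x ⟧) (trans (==-≢ (A≢ AY Ab ∘ sym))
                                          (sym (==-≢ (A≢ AY AX ∘ sym)))) ⟩
              s + ⟦ X == Y ⟧         ∎
              where
              open ≡-Reasoning
              X≢Y : X ≢ Y
              X≢Y = A≢ AY AX ∘ sym
              swapped : ∀ v → ⟦ P v ∧ c v == Y ⟧ + ⟦ v == z ⟧ * ⟦ W == Y ⟧
                            ≡ ⟦ P v ∧ f v == Y ⟧ + ⟦ v == y₁ ⟧ * ⟦ W == Y ⟧
              swapped v = by-kind (kind v)
                where
                by-kind : Kind v → ⟦ P v ∧ c v == Y ⟧ + ⟦ v == z ⟧ * ⟦ W == Y ⟧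
                                 ≡ ⟦ P v ∧ f v == Y ⟧ + ⟦ v == y₁ ⟧ * ⟦ W == Y ⟧
                by-kind (is-z refl cv) = balance false true (W == Y) false
                  (==-excluded (P z) λ _ → subst (_≢ Y) (sym cv) X≢Y) (==-refl z)
                  (cong (_∧ W == Y) Pz) (==-≢ z≢y₁) refl
                by-kind (is-y₁ refl cv) = balance (W == Y) false false true
                  (cong₂ _∧_ P₁ (cong (_== Y) cv)) (==-≢ (z≢y₁ ∘ sym))
                  (==-excluded (P y₁) λ _ → A≢ AY A₁ ∘ sym) (==-refl y₁) refl
                by-kind (in-A v≢z v≢y₁ Av cv) = balance (P v ∧ f v == Y) false (P v ∧ f v == Y) false
                  (cong (λ Z → P v ∧ Z == Y) cv) (==-≢ v≢z) refl (==-≢ v≢y₁) refl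
                by-kind (in-B v≢z v≢y₁ Av cv) = balance false false false false
                  (==-excluded (P v) λ Pv → subst (_≢ Y) (sym cv) (A≢ AY (¬A-h Pv v≢y₁ Av) ∘ sym)) (==-≢ v≢z)
                  (==-excluded (P v) λ _ → A≢ AY Av ∘ sym) (==-≢ v≢y₁) refl
            by-cases false AY = begin
              size c Y + ⟦ a == Y ⟧  ≡⟨ cong (λ x → size c Y + ⟦ x ⟧) (==-≢ (A≢ Aa AY)) ⟩
              size c Y + 0           ≡⟨ +-identityʳ _ ⟩
              size c Y               ≡⟨ count-extend z (X == Y) joined ⟩
              count (λ v → B⁻ v ∧ h v == Y) + ⟦ X == Y ⟧
                                     ≡⟨ cong (_+ ⟦ X == Y ⟧) (H.sizes Y (R-intro CY AY)) ⟩
              s + ⟦ X == Y ⟧         ∎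
              where
              open ≡-Reasoning
              joined : ∀ v → ⟦ P v ∧ c v == Y ⟧ ≡ ⟦ B⁻ v ∧ h v == Y ⟧ + ⟦ v == z ⟧ * ⟦ X == Y ⟧
              joined v = trans (sym (+-identityʳ _)) (by-kind (kind v))
                where
                by-kind : Kind v → ⟦ P v ∧ c v == Y ⟧ + 0 * ⟦ X == Y ⟧
                                 ≡ ⟦ B⁻ v ∧ h v == Y ⟧ + ⟦ v == z ⟧ * ⟦ X == Y ⟧
                by-kind (is-z refl cv) = balance (X == Y) false false true
                  (cong₂ _∧_ Pz (cong (_== Y) cv)) refl
                  (==-excluded (B⁻ z) {h z} λ B⁻z → false≢true (B⁻⇒¬A B⁻z) AW) (==-refl z) refl
                by-kind (is-y₁ refl cv) = balance false false false false
                  (==-excluded (P y₁) λ _ → subst (_≢ Y) (sym cv) (A≢ AW AY)) refl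
                  (==-excluded (B⁻ y₁) {h y₁} λ B⁻y₁ → false≢true (cong not (==-refl y₁)) (∧-elimʳ {B y₁} B⁻y₁))
                  (==-≢ (z≢y₁ ∘ sym)) refl
                by-kind (in-A v≢z v≢y₁ Av cv) = balance false false false false
                  (==-excluded (P v) λ _ → subst (_≢ Y) (sym cv) (A≢ Av AY)) refl
                  (==-excluded (B⁻ v) {h v} λ B⁻v → false≢true (B⁻⇒¬A B⁻v) Av) (==-≢ v≢z) refl
                by-kind (in-B v≢z v≢y₁ Av cv) = balance (B⁻ v ∧ h v == Y) false (B⁻ v ∧ h v == Y) false
                  (cong₂ _∧_ (sym (B⁻≡P v≢y₁ Av)) (cong (_== Y) cv)) refl refl (==-≢ v≢z) refl

        c-keeps : ∀ v → A (f v) ≡ true → f v ≢ W → c v ≡ f v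
        c-keeps v Av fv≢W with kind v
        ... | is-z refl _   = contradiction refl fv≢W
        ... | is-y₁ refl _  = false≢true A₁ Av
        ... | in-A _ _ _ cv = cv
        ... | in-B _ _ Av′ _ = false≢true Av′ Av

        c-reflects : ∀ v → P v ≡ true → A (c v) ≡ true → c v ≢ W → f v ≡ c v
        c-reflects v Pv Acv cv≢W with kind v
        ... | is-z refl cv      = false≢true (trans (cong A cv) AX) Acv
        ... | is-y₁ refl cv     = contradiction cv cv≢W
        ... | in-A _ _ _ cv     = sym cv
        ... | in-B _ v≢y₁ Av cv = false≢true (trans (cong A cv) (¬A-h Pv v≢y₁ Av)) Acv

        c-class-W : ∀ v → P v ≡ true → c v ≡ W → v ≡ y₁ ⊎ (f v ≡ W × v ≢ z)
        c-class-W v Pv cvW with kind v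
        ... | is-z refl cv       = contradiction (trans (sym cvW) cv) (A≢ AW AX)
        ... | is-y₁ v≡y₁ _       = inj₁ v≡y₁
        ... | in-A v≢z _ _ cv    = inj₂ (trans (sym cv) cvW , v≢z)
        ... | in-B _ v≢y₁ Av cv  = contradiction (trans (sym cvW) cv) (A≢ AW (¬A-h Pv v≢y₁ Av))

        module A′ = Reach (reach c a C)

        -- `W` is terminal, and among the accessible classes it is the only one whose content
        -- changes, so the old paths around `W` survive.
        others-accessible : ∀ {Y} → A Y ≡ true → Y ≢ W → A′.set Y ≡ true
        others-accessible AY Y≢W with Reach.path (free-of W) (terminal (solo-T {y₁} sol₁) AY Y≢W)
        ... | L , path , L⊆ = A′.complete
          (path-cong (λ v _ fv∈ → c-keeps v (S⇒A (L⊆ fv∈)) (S⇒≢ (L⊆ fv∈)))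
                     (λ v Pv cv∈ → c-reflects v Pv (S⇒A (L⊆ (there cv∈))) (S⇒≢ (L⊆ (there cv∈)))) path)
          (A⊆C ∘ S⇒A ∘ L⊆)

        -- Some `w` in `W` could move to another accessible class. It is not `z`, which is
        -- immovable, so it is still in `W` and still movable.
        W-accessible : A′.set W ≡ true
        W-accessible with Reach.path (reach f a C) AW
        ... | .[] , done , _ = A′.root Ca
        ... | _ , step {Y = Y} {L} w Pw fw free W∉ path , L⊆ =
          A′.closed (A⊆C AW) Pw cw (others-accessible AY Y≢W)
            (λ u Pu wu cu → free u Pu wu (trans (c-reflects u Pu (subst (λ Z → A Z ≡ true) (sym cu) AY)
                                                   (λ cuW → Y≢W (trans (sym cu) cuW))) cu))
          where
          AY : A Y ≡ true
          AY = L⊆ (there (here refl))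
          Y≢W : Y ≢ W
          Y≢W eq = W∉ (here (sym eq))
          w≢z : w ≢ z
          w≢z refl = imm AY Y≢W free
          cw : c w ≡ W
          cw with kind w
          ... | is-z w≡z _      = contradiction w≡z w≢z
          ... | is-y₁ _ cv      = cv
          ... | in-A _ _ _ cv   = trans cv fw
          ... | in-B _ _ Aw _   = false≢true Aw (trans (cong A fw) AW)

        accessible : ∀ {Y} → A Y ≡ true → A′.set Y ≡ true
        accessible {Y} AY with Y ≟ W
        ... | yes refl = W-accessible
        ... | no Y≢W   = others-accessible AY Y≢W

        B⁻y₂ : B⁻ y₂ ≡ true
        B⁻y₂ = ∧-intro B₂ (cong not (==-≢ (y₁≢y₂ ∘ sym)))

        c-y₂ : c y₂ ≡ h y₂
        c-y₂ with kind y₂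
        ... | is-z refl _     = false≢true (not-true (∧-elimʳ {P z} B₂)) AW
        ... | is-y₁ y₂≡y₁ _   = contradiction (sym y₂≡y₁) y₁≢y₂
        ... | in-A _ _ A₂ _   = false≢true (not-true (∧-elimʳ {P y₂} B₂)) A₂
        ... | in-B _ _ _ cv   = cv

        -- The only neighbour of `y₂` in `W` was `z`, which has left, and the newcomer `y₁` is not
        -- adjacent to `y₂`; so `y₂` is now movable to `W`.
        y₂-accessible : A′.set (h y₂) ≡ true
        y₂-accessible = A′.closed (∧-elimˡ (h∈R y₂ B⁻y₂)) (∧-elimˡ B₂) c-y₂ W-accessible
          λ u Pu y₂u cu → case c-class-W u Pu cu of λ where
            (inj₁ refl) → false≢true (trans (adj-sym y₂ y₁) y₁y₂) y₂u
            (inj₂ (fu , u≢z)) → u≢z (solo-unique sol₂ Pu y₂u fu)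

        newly : inaccessible c (h y₂) ≡ false
        newly rewrite y₂-accessible = Bool.∧-zeroʳ (C (h y₂))

        shrink : ∀ Y → inaccessible c Y ≡ true → R Y ≡ true
        shrink Y t = R-intro (∧-elimˡ t) (Bool.¬-not λ AY →
          false≢true (cong not (accessible AY)) (∧-elimʳ {C Y} t))

      -- `z` has at most `β` neighbours in `B`, and `y₁` is one of them. The others cannot meet all
      -- `β` classes of the new colouring of `B` without `y₁`, and a class that they miss can
      -- receive `z`.
      swap-immovable : ∀ {y₁ y₂ z} → B y₁ ≡ true → B y₂ ≡ true → y₁ ≢ y₂ → adj y₁ y₂ ≡ false →
                       solo y₁ z ≡ true → solo y₂ z ≡ true → Immovable z → Equitable G P C s
      swap-immovable {y₁} {y₂} {z} B₁ B₂ y₁≢y₂ y₁y₂ sol₁ sol₂ imm with sum-pigeonhole few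
        where
        B⁻ : Fin n → Bool
        B⁻ v = B v ∧ not (v == y₁)
        h = Equitable.colour (recolour-B B₁)
        few : sum (λ Y → ⟦ R Y ⟧ * count (λ u → (B⁻ u ∧ adj z u) ∧ h u == Y)) < count R
        few = begin-strict
          sum (λ Y → ⟦ R Y ⟧ * count (λ u → (B⁻ u ∧ adj z u) ∧ h u == Y))
            ≡⟨ count-fibres h (λ u → B⁻ u ∧ adj z u) R ⟩
          count (λ u → (B⁻ u ∧ adj z u) ∧ R (h u))
            <⟨ count-strict sub y₁ (∧-intro (∧-intro (∧-elimˡ B₁) z-y₁) (∧-elimʳ {P y₁} B₁)) y₁-out ⟩
          dB z
            ≤⟨ dB-immovable (solo-P {y₁} sol₁) (T⇒A (solo-T {y₁} sol₁)) imm ⟩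
          β ∎
          where
          open ≤-Reasoning
          z-y₁ : adj z y₁ ≡ true
          z-y₁ = trans (adj-sym z y₁) (solo-adj {y₁} sol₁)
          y₁-out : (B⁻ y₁ ∧ adj z y₁) ∧ R (h y₁) ≡ false
          y₁-out rewrite ==-refl y₁ | Bool.∧-zeroʳ (B y₁) = refl
          sub : ∀ u → (B⁻ u ∧ adj z u) ∧ R (h u) ≡ true → (P u ∧ adj z u) ∧ not (A (f u)) ≡ true
          sub u x = ∧-intro (∧-intro (∧-elimˡ Bu) (∧-elimʳ {B⁻ u} (∧-elimˡ x))) (∧-elimʳ {P u} Bu)
            where
            Bu : B u ≡ true
            Bu = ∧-elimˡ {B u} (∧-elimˡ (∧-elimˡ x))
      ... | X , lt with R X in RX
      ...   | true = swap-into B₁ B₂ y₁≢y₂ y₁y₂ sol₁ sol₂ imm (recolour-B B₁) X RX λ v B⁻v zv hv →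
        false≢true (count≡0⇒false (n<1⇒n≡0 (subst (_< 1) (+-identityʳ _) lt)) v)
          (∧-intro (∧-intro B⁻v zv) (subst (λ Y → Equitable.colour (recolour-B B₁) v == Y ≡ true) hv
                                           (==-refl (Equitable.colour (recolour-B B₁) v))))

      -- An independent set with many solo edges

      Independent : (Fin n → Bool) → Set
      Independent I = (∀ {y} → I y ≡ true → B y ≡ true)
                    × (∀ {y y′} → I y ≡ true → I y′ ≡ true → adj y y′ ≡ false)

      MaximalIndependent : Set
      MaximalIndependent = ∃ λ I → Independent I × (∀ v → B v ≡ true →
        ∃ λ u → I u ≡ true × (v ≡ u ⊎ adj u v ≡ true))

      maximal-independent : MaximalIndependent
      maximal-independent = saturate Independent grow (λ _ → false) ((λ ()) , (λ ()))
        where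
        grow : ∀ I → Independent I → MaximalIndependent ⊎ ∃ λ v → I v ≡ false × Independent (insert v I)
        grow I ind@(I⊆B , indep) with Fin.any? (λ v → (I v Bool.≟ false) ×-dec (B v Bool.≟ true) ×-dec
                                    ¬? (Fin.any? λ u → (I u Bool.≟ true) ×-dec (adj u v Bool.≟ true)))
        ... | yes (v , Iv , Bv , none) = inj₂ (v , Iv ,
                (λ {y} → insert-elim v I {B y ≡ true} {y} (λ { refl → Bv }) I⊆B) ,
                (λ {y} {y′} Iy Iy′ → insert-elim v I {adj y y′ ≡ false} {y}
                  (λ { refl → insert-elim v I {adj v y′ ≡ false} {y′} (λ { refl → adj-irr v })
                                 (λ Iy′ → trans (adj-sym v y′) (apart Iy′)) Iy′ })
                  (λ Iy → insert-elim v I {adj y y′ ≡ false} {y′} (λ { refl → apart Iy }) (indep Iy) Iy′) Iy))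
          where
          apart : ∀ {u} → I u ≡ true → adj u v ≡ false
          apart {u} Iu = Bool.¬-not λ uv → none (u , Iu , uv)
        ... | no ∄ = inj₁ (I , ind , dominated)
          where
          dominated : ∀ v → B v ≡ true → ∃ λ u → I u ≡ true × (v ≡ u ⊎ adj u v ≡ true)
          dominated v Bv with I v in Iv
          ... | true = v , Iv , inj₁ refl
          ... | false with Fin.any? (λ u → (I u Bool.≟ true) ×-dec (adj u v Bool.≟ true))
          ...   | yes (u , Iu , uv) = u , Iu , inj₂ uv
          ...   | no none = contradiction (v , Iv , Bv , none) ∄

      -- By maximality the closed neighbourhoods of the members of `I` cover `B`.
      count-B≤ : ∀ (I : Fin n → Bool) → (∀ v → B v ≡ true → ∃ λ u → I u ≡ true × (v ≡ u ⊎ adj u v ≡ true)) →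
                 suc (β * s) ≤ sum (λ y → ⟦ I y ⟧ * suc (dB y))
      count-B≤ I dominated = begin
        suc (β * s)                                           ≡⟨ count-B ⟨
        count B                                               ≤⟨ sum-mono covered ⟩
        sum (λ v → sum (λ y → ⟦ I y ⟧ * reach₁ y v))          ≡⟨ ∑-comm _ ⟩
        sum (λ y → sum (λ v → ⟦ I y ⟧ * reach₁ y v))          ≡⟨ sum-cong-≗ (λ y → *-distribˡ-sum ⟦ I y ⟧ _) ⟨
        sum (λ y → ⟦ I y ⟧ * sum (reach₁ y))                  ≡⟨ sum-cong-≗ (λ y → cong (⟦ I y ⟧ *_) (total y)) ⟩
        sum (λ y → ⟦ I y ⟧ * suc (dB y))                      ∎
        where
        open ≤-Reasoning
        reach₁ : Fin n → Fin n → ℕ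
        reach₁ y v = ⟦ v == y ⟧ + ⟦ (P v ∧ adj y v) ∧ not (A (f v)) ⟧
        total : ∀ y → sum (reach₁ y) ≡ suc (dB y)
        total y = trans (∑-distrib-+ _ _) (cong (_+ dB y) (count-singleton y))
        covered : ∀ v → ⟦ B v ⟧ ≤ sum (λ y → ⟦ I y ⟧ * reach₁ y v)
        covered v = by-cases (B v) refl
          where
          by-cases : ∀ x → B v ≡ x → ⟦ x ⟧ ≤ sum (λ y → ⟦ I y ⟧ * reach₁ y v)
          by-cases false _ = z≤n
          by-cases true Bv with dominated v Bv
          ... | u , Iu , near-u = begin
            1                                    ≤⟨ one near-u ⟩
            reach₁ u v                           ≡⟨ *-identityˡ (reach₁ u v) ⟨
            1 * reach₁ u v                       ≡⟨ cong (λ x → ⟦ x ⟧ * reach₁ u v) Iu ⟨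
            ⟦ I u ⟧ * reach₁ u v                 ≤⟨ term≤sum (λ y → ⟦ I y ⟧ * reach₁ y v) u ⟩
            sum (λ y → ⟦ I y ⟧ * reach₁ y v)     ∎
            where
            one : v ≡ u ⊎ adj u v ≡ true → 1 ≤ reach₁ u v
            one (inj₁ refl) = ≤-trans (≤-reflexive (sym (cong ⟦_⟧ (==-refl v)))) (m≤m+n _ _)
            one (inj₂ uv) = ≤-trans (≤-reflexive (sym (cong ⟦_⟧ (∧-intro (∧-intro (∧-elimˡ Bv) uv) (∧-elimʳ {P v} Bv)))))
                                    (m≤n+m _ ⟦ v == u ⟧)

      Movable-Solo : Set
      Movable-Solo = ∃ λ y → ∃₂ λ z X →
        B y ≡ true × solo y z ≡ true × A X ≡ true × X ≢ f z × Free f z X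

      opaque
        movable-solo? : Dec Movable-Solo
        movable-solo? = Fin.any? λ y → Fin.any? λ z → Fin.any? λ X →
          (B y Bool.≟ true) ×-dec (solo y z Bool.≟ true) ×-dec (A X Bool.≟ true) ×-dec
          ¬? (X ≟ f z) ×-dec free? f z X

        solo? : ∀ z → Dec (∃ λ y → B y ≡ true × solo y z ≡ true)
        solo? z = Fin.any? λ y → (B y Bool.≟ true) ×-dec (solo y z Bool.≟ true)

      module _ (immovable : ∀ {y z} → B y ≡ true → solo y z ≡ true → Immovable z) where

        -- Otherwise weights 2 on the solo and 1 on the other vertices of a terminal class
        -- contradict overcount.
        β<t : β < t
        β<t = ≰⇒> λ t≤β → overcount (T⇒A TW) 1 weight supply (demand t≤β)
          where
          W = proj₁ inhabited
          TW : T U W ≡ true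
          TW = proj₂ inhabited
          weight : Fin n → ℕ
          weight z = suc ⟦ does (solo? z) ⟧
          supply : ∀ y → B y ≡ true → 2 ≤ sum (λ z → ⟦ (P z ∧ adj y z) ∧ f z == W ⟧ * weight z)
          supply y By = by-cases (nb f y W ℕ.≟ 1)
            where
            N : Fin n → Bool
            N z = (P z ∧ adj y z) ∧ f z == W
            by-cases : Dec (nb f y W ≡ 1) → 2 ≤ sum (λ z → ⟦ N z ⟧ * weight z)
            by-cases (yes one) = begin
              2                              ≡⟨ cong (_* 2) one ⟨
              nb f y W * 2                   ≡⟨ sum-weighted N 2 ⟨
              sum (λ z → ⟦ N z ⟧ * 2)        ≤⟨ sum-mono (λ z → ⟦⟧*-mono (λ Nz →
                                                  s≤s (≤-reflexive (sym (cong ⟦_⟧ (dec-true (solo? z) (y , By , is-solo z Nz))))))) ⟩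
              sum (λ z → ⟦ N z ⟧ * weight z) ∎
              where
              open ≤-Reasoning
              is-solo : ∀ z → N z ≡ true → solo y z ≡ true
              is-solo z Nz = ∧-intro {P z ∧ adj y z} (∧-elimˡ {P z ∧ adj y z} Nz)
                (subst (λ X → T U X ∧ (nb f y X ≡ᵇ 1) ≡ true) (sym (==⇒≡ {i = f z} {W} (∧-elimʳ {P z ∧ adj y z} Nz)))
                       (∧-intro TW (cong (_≡ᵇ 1) one)))
            by-cases (no many) = begin
              2                              ≤⟨ ≤∧≢⇒< (blocked By (T⇒A TW)) (many ∘ sym) ⟩
              nb f y W                       ≡⟨ *-identityʳ (nb f y W) ⟨
              nb f y W * 1                   ≡⟨ sum-weighted N 1 ⟨
              sum (λ z → ⟦ N z ⟧ * 1)        ≤⟨ sum-mono (λ z → ⟦⟧*-mono {N z} (λ _ → s≤s z≤n)) ⟩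
              sum (λ z → ⟦ N z ⟧ * weight z) ∎
              where open ≤-Reasoning
          -- A solo vertex is immovable, so twice its at most `β` neighbours are allowed; any other
          -- vertex of `W` has at most `β + t` of them, which is at most `2 * β` as well.
          demand : t ≤ β → ∀ z → P z ≡ true → f z ≡ W → dB z * weight z ≤ 2 * β
          demand t≤β z Pz refl with solo? z
          ... | yes (y , By , sol) = begin
            dB z * 2    ≤⟨ *-monoˡ-≤ 2 (dB-immovable Pz (T⇒A TW) (immovable By sol)) ⟩
            β * 2       ≡⟨ *-comm β 2 ⟩
            2 * β       ∎
            where open ≤-Reasoning
          ... | no _ = begin
            dB z * 1    ≡⟨ *-identityʳ (dB z) ⟩
            dB z        ≤⟨ dB-terminal Pz TW ⟩
            β + t       ≤⟨ +-monoʳ-≤ β t≤β ⟩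
            β + β       ≡⟨ cong (β +_) (+-identityʳ β) ⟨
            2 * β       ∎
            where open ≤-Reasoning

        size-T≤ : count (λ z → P z ∧ T U (f z)) ≤ t * s
        size-T≤ = begin
          count (λ z → P z ∧ T U (f z))         ≡⟨ count-fibres f P (T U) ⟨
          sum (λ X → ⟦ T U X ⟧ * size f X)      ≤⟨ sum-mono (λ X → ⟦⟧*-mono {T U X} (λ TX → size-A≤ (T⇒A {U} {X} TX))) ⟩
          sum (λ X → ⟦ T U X ⟧ * s)             ≡⟨ sum-weighted (T U) s ⟩
          t * s                                 ∎
          where open ≤-Reasoning

        -- Summing `solo-count` over `I` yields at least `count I * (t - β) + (β * s + 1)` solo
        -- edges, and `s ≤ count I` turns this into `t * s + 1`.
        many-solo : ∀ I → Independent I → suc (β * s) ≤ sum (λ y → ⟦ I y ⟧ * suc (dB y)) →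
                    t * s < sum (λ y → ⟦ I y ⟧ * count (solo y))
        many-solo I (I⊆B , _) large = +-cancelˡ-≤ (count I * β) _ _ (begin
          count I * β + suc (t * s)
            ≡⟨ cong (λ m → count I * β + suc (m * s)) t≡ ⟩
          count I * β + suc ((β + t′) * s)
            ≡⟨ arrange (count I) β t′ s ⟩
          count I * β + (s * t′ + suc (β * s))
            ≤⟨ +-monoʳ-≤ (count I * β) (+-mono-≤ (*-monoˡ-≤ t′ s≤I) large) ⟩
          count I * β + (count I * t′ + σ)
            ≡⟨ regroup (count I) β t′ σ ⟩
          count I * (β + t′) + σ
            ≡⟨ cong (λ m → count I * m + σ) t≡ ⟨
          count I * t + σ
            ≡⟨ cong (_+ σ) (sum-weighted I t) ⟨
          sum (λ y → ⟦ I y ⟧ * t) + σ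
            ≡⟨ ∑-distrib-+ _ _ ⟨
          sum (λ y → ⟦ I y ⟧ * t + ⟦ I y ⟧ * suc (dB y))
            ≡⟨ sum-cong-≗ (λ y → *-distribˡ-+ ⟦ I y ⟧ t (suc (dB y))) ⟨
          sum (λ y → ⟦ I y ⟧ * (t + suc (dB y)))
            ≤⟨ sum-mono (λ y → ⟦⟧*-mono (λ Iy → solo-count (I⊆B Iy))) ⟩
          sum (λ y → ⟦ I y ⟧ * (β + count (solo y)))
            ≡⟨ sum-cong-≗ (λ y → *-distribˡ-+ ⟦ I y ⟧ β (count (solo y))) ⟩
          sum (λ y → ⟦ I y ⟧ * β + ⟦ I y ⟧ * count (solo y))
            ≡⟨ ∑-distrib-+ _ _ ⟩
          sum (λ y → ⟦ I y ⟧ * β) + sum (λ y → ⟦ I y ⟧ * count (solo y))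
            ≡⟨ cong (_+ sum (λ y → ⟦ I y ⟧ * count (solo y))) (sum-weighted I β) ⟩
          count I * β + sum (λ y → ⟦ I y ⟧ * count (solo y)) ∎)
          where
          open ≤-Reasoning
          t′ = t ∸ β
          t≡ : t ≡ β + t′
          t≡ = sym (m+[n∸m]≡n (<⇒≤ β<t))
          σ : ℕ
          σ = sum (λ y → ⟦ I y ⟧ * suc (dB y))
          arrange : ∀ i β t′ s → i * β + suc ((β + t′) * s) ≡ i * β + (s * t′ + suc (β * s))
          arrange = solve-∀
          regroup : ∀ i β t′ σ → i * β + (i * t′ + σ) ≡ i * (β + t′) + σ
          regroup = solve-∀
          -- Each closed neighbourhood in `B` has at most `β` vertices, and together they hold more
          -- than `β * s`.
          s≤I : s ≤ count I
          s≤I = <⇒≤ (*-cancelʳ-< β s (count I) (begin-strict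
            s * β                                 ≡⟨ *-comm s β ⟩
            β * s                                 <⟨ large ⟩
            σ                                     ≤⟨ sum-mono (λ y → ⟦⟧*-mono (λ Iy → dB<β (I⊆B Iy))) ⟩
            sum (λ y → ⟦ I y ⟧ * β)               ≡⟨ sum-weighted I β ⟩
            count I * β                           ∎))

        common-solo : ∀ I → Independent I → suc (β * s) ≤ sum (λ y → ⟦ I y ⟧ * suc (dB y)) →
                      ∃ λ z → 2 ≤ count (λ y → I y ∧ solo y z)
        common-solo I ind large = proj₁ crowded , two (proj₁ crowded) (proj₂ crowded)
          where
          open ≤-Reasoning
          crowded : ∃ λ z → ⟦ P z ∧ T U (f z) ⟧ < count (λ y → I y ∧ solo y z)
          crowded = sum-pigeonhole (begin-strict
            count (λ z → P z ∧ T U (f z))                        ≤⟨ size-T≤ ⟩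
            t * s                                                <⟨ many-solo I ind large ⟩
            sum (λ y → ⟦ I y ⟧ * count (solo y))                 ≡⟨ sum-cong-≗ (λ y → *-distribˡ-sum ⟦ I y ⟧ _) ⟩
            sum (λ y → sum (λ z → ⟦ I y ⟧ * ⟦ solo y z ⟧))       ≡⟨ ∑-comm _ ⟩
            sum (λ z → sum (λ y → ⟦ I y ⟧ * ⟦ solo y z ⟧))       ≡⟨ sum-cong-≗ (λ z → sum-cong-≗ (λ y → ⟦∧⟧ (I y) (solo y z))) ⟨
            sum (λ z → count (λ y → I y ∧ solo y z))             ∎)
          -- A solo edge at `z` puts `z` in a class of `T U`, so the left-hand indicator is 1 and
          -- the count exceeds it.
          two : ∀ z → ⟦ P z ∧ T U (f z) ⟧ < count (λ y → I y ∧ solo y z) → 2 ≤ count (λ y → I y ∧ solo y z)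
          two z lt with count>0⇒∃ (≤-<-trans z≤n lt)
          ... | y , Iy-sol = subst (λ m → m < count (λ y → I y ∧ solo y z))
            (cong ⟦_⟧ (∧-intro (solo-P {y} (∧-elimʳ {I y} Iy-sol)) (solo-T {y} (∧-elimʳ {I y} Iy-sol)))) lt

      no-movable-solo : ¬ Movable-Solo → Equitable G P C s
      no-movable-solo ∄ = by-maximal maximal-independent
        where
        immovable : ∀ {y z} → B y ≡ true → solo y z ≡ true → Immovable z
        immovable {y} {z} By sol {X} AX X≢fz free = ∄ (y , z , X , By , sol , AX , X≢fz , free)
        by-pair : ∀ I → Independent I → ∀ z → (∃₂ λ y₁ y₂ → y₁ ≢ y₂ × I y₁ ∧ solo y₁ z ≡ true × I y₂ ∧ solo y₂ z ≡ true) →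
                  Equitable G P C s
        by-pair I (I⊆B , indep) z (y₁ , y₂ , y₁≢y₂ , y₁∈ , y₂∈) =
          swap-immovable (I⊆B I₁) (I⊆B I₂) y₁≢y₂ (indep I₁ I₂) sol₁ sol₂ (immovable (I⊆B I₁) sol₁)
          where
          I₁ : I y₁ ≡ true
          I₁ = ∧-elimˡ y₁∈
          I₂ : I y₂ ≡ true
          I₂ = ∧-elimˡ y₂∈
          sol₁ : solo y₁ z ≡ true
          sol₁ = ∧-elimʳ {I y₁} y₁∈
          sol₂ : solo y₂ z ≡ true
          sol₂ = ∧-elimʳ {I y₂} y₂∈
        by-maximal : MaximalIndependent → Equitable G P C s
        by-maximal (I , ind , dominated) = by-pair I ind (proj₁ common) (count≥2⇒∃₂ (proj₂ common))
          where
          common : ∃ λ z → 2 ≤ count (λ y → I y ∧ solo y z)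
          common = common-solo immovable I ind (count-B≤ I dominated)

      equitable : Equitable G P C s
      equitable = by-cases movable-solo?
        where
        by-cases : Dec Movable-Solo → Equitable G P C s
        by-cases (yes (y , z , X , By , sol , AX , X≢fz , free)) = replace-movable By sol AX X≢fz free
        by-cases (no ∄) = no-movable-solo ∄

  near⇒equitable : ∀ {f b} → Near f b → Equitable G P C s
  near⇒equitable {f} near = go near (<-wellFounded (count (inaccessible f)))
    where
    go : ∀ {f b} → Near f b → Acc _<_ (count (inaccessible f)) → Equitable G P C s
    go {f} {b} near (acc rec) = by-cases (Reach.set (reach f a C) b) refl
      where
      by-cases : ∀ x → Reach.set (reach f a C) b ≡ x → Equitable G P C s
      by-cases true Ab = shift-to-equitable near Ab
      by-cases false Ab = Stuck.Terminals.equitable near Ab (λ near′ lt → go near′ (rec lt))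
        (Stuck.terminal-family near Ab improve a Aa (Stuck.T-a-inhabited near Ab improve))
        where
        improve : ∀ {f′ b′} → Near f′ b′ → count (inaccessible f′) < count (inaccessible f) → Equitable G P C s
        improve near′ lt = go near′ (rec lt)
        Aa = Reach.root (reach f a C) Ca

-- Inserting the edges: the Hajnal-Szemerédi theorem

restrict : Graph n → (Fin n → Bool) → Graph n
restrict G Q = record
  { adj     = λ u v → G.adj u v ∧ (Q u ∧ Q v)
  ; adj-sym = λ u v → cong₂ _∧_ (G.adj-sym u v) (Bool.∧-comm (Q u) (Q v))
  ; adj-irr = λ v → cong (_∧ (Q v ∧ Q v)) (G.adj-irr v)
  }
  where module G = Graph G

restrict-degree : ∀ (G : Graph n) Q {P c} → DegreeBelow G P c → DegreeBelow (restrict G Q) P c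
restrict-degree G Q {P} deg v Pv = ≤-<-trans
  (count-mono λ u t → ∧-intro {P u} (∧-elimˡ t) (∧-elimˡ {Graph.adj G v u} (∧-elimʳ {P u} t))) (deg v Pv)

module Activation {n k : ℕ} (G : Graph n) (P : Fin n → Bool) (C : Fin k → Bool) (s : ℕ)
  (degree : DegreeBelow G P (count C))
  (fewer-colours : ∀ (G′ : Graph n) P′ (C′ : Fin k → Bool) → count C′ < count C →
                   count P′ ≡ count C′ * s → DegreeBelow G′ P′ (count C′) → Equitable G′ P′ C′ s) where

  -- The start of the insertion: all vertices of `P` are present but no edge is, so any partition
  -- with the right sizes will do.
  isolated : Fin k → count P ≡ count C * s → Equitable (restrict G λ _ → false) P C s
  isolated d P≡ with prescribed-fibres d P (λ X → ⟦ C X ⟧ * s) (trans (sum-weighted C s) (sym P≡))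
  ... | f , sizes = record
    { colour  = f
    -- Classes outside `C` have quota 0, so no vertex of `P` receives such a colour.
    ; colour∈ = λ v Pv → Bool.¬-not λ Cfv → contradiction
        (∃⇒count>0 {p = λ u → P u ∧ f u == f v} v (∧-intro Pv (==-refl (f v))))
        (≤⇒≯ (≤-reflexive (trans (sizes (f v)) (cong (λ x → ⟦ x ⟧ * s) Cfv))))
    ; proper  = λ u v _ _ uv → false≢true (Bool.∧-zeroʳ (Graph.adj G u v)) uv
    ; sizes   = λ X CX → trans (sizes X) (trans (cong (λ x → ⟦ x ⟧ * s) CX) (+-identityʳ s))
    }

  module _ (Q : Fin n → Bool) (e : Equitable (restrict G Q) P C s) (v : Fin n) where
    open Equitable e renaming (colour to f)

    G′ : Graph n
    G′ = restrict G (insert v Q)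

    old-edge : ∀ {u w} → u ≢ v → w ≢ v → Graph.adj G′ u w ≡ true → Graph.adj (restrict G Q) u w ≡ true
    old-edge {u} {w} u≢v w≢v uw = ∧-intro {Graph.adj G u w} (∧-elimˡ uw)
      (subst₂ (λ x y → (x ∨ Q u) ∧ (y ∨ Q w) ≡ true) (==-≢ u≢v) (==-≢ w≢v) (∧-elimʳ {Graph.adj G u w} uw))

    activate-outside : P v ≡ false → Equitable G′ P C s
    activate-outside Pv = record
      { colour = f ; colour∈ = colour∈ ; sizes = sizes
      ; proper = λ u w Pu Pw uw → proper u w Pu Pw (old-edge (inside Pu) (inside Pw) uw) }
      where
      inside : ∀ {u} → P u ≡ true → u ≢ v
      inside Pu refl = false≢true Pv Pu

    open Colouring {k = k} G′ P

    -- `v` has fewer neighbours in `P` than there are classes, so some class contains none of them.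
    free-colour : P v ≡ true → ∃ λ Y → C Y ≡ true × Free f v Y
    free-colour Pv = Y , positive (C Y) (proj₂ roomy)
      where
      open ≤-Reasoning
      roomy : ∃ λ Y → ⟦ C Y ⟧ * nb f v Y < ⟦ C Y ⟧
      roomy = sum-pigeonhole (begin-strict
        sum (λ X → ⟦ C X ⟧ * nb f v X)                          ≡⟨ count-fibres f (λ u → P u ∧ Graph.adj G′ v u) C ⟩
        count (λ u → (P u ∧ Graph.adj G′ v u) ∧ C (f u))        ≤⟨ count-mono (λ u → ∧-elimˡ) ⟩
        count (λ u → P u ∧ Graph.adj G′ v u)                    <⟨ restrict-degree G (insert v Q) degree v Pv ⟩
        count C                                                 ∎)
      Y = proj₁ roomy
      positive : ∀ x → ⟦ x ⟧ * nb f v Y < ⟦ x ⟧ → x ≡ true × Free f v Y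
      positive true lt = refl , nb≡0⇒Free (n<1⇒n≡0 (subst (_< 1) (+-identityʳ (nb f v Y)) lt))

    activate-inside : P v ≡ true → Equitable G′ P C s
    activate-inside Pv = near⇒equitable record
      { colour∈ = recoloured∈
      ; proper  = recolour-proper (λ u w u≢v w≢v Pu Pw uw → proper u w Pu Pw (old-edge u≢v w≢v uw)) free
      ; large∈  = CY
      ; sizes   = λ X CX → trans (recolour-size f v Y X Pv) (cong (_+ ⟦ Y == X ⟧) (sizes X CX))
      }
      where
      open NearlyEquitable G′ P C s (restrict-degree G (insert v Q) degree) (fewer-colours G′)
        (f v) (colour∈ v Pv)
      Y = proj₁ (free-colour Pv)
      CY : C Y ≡ true
      CY = proj₁ (proj₂ (free-colour Pv))
      free : Free f v Y
      free = proj₂ (proj₂ (free-colour Pv))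
      recoloured∈ : ∀ u → P u ≡ true → C (recolour f v Y u) ≡ true
      recoloured∈ u Pu = by-cases (u ≟ v)
        where
        by-cases : Dec (u ≡ v) → C (recolour f v Y u) ≡ true
        by-cases (yes refl) = trans (cong C (recolour-same f v Y)) CY
        by-cases (no u≢v)   = trans (cong C (recolour-other f v Y u≢v)) (colour∈ u Pu)

    activate : Equitable G′ P C s
    activate = by-cases (P v) refl
      where
      by-cases : ∀ x → P v ≡ x → Equitable G′ P C s
      by-cases true  = activate-inside
      by-cases false = activate-outside

  equitable-colouring : Fin k → count P ≡ count C * s → Equitable G P C s
  equitable-colouring d P≡ =
    saturate (λ Q → Equitable (restrict G Q) P C s) grow (λ _ → false) (isolated d P≡)
    where
    grow : ∀ Q → Equitable (restrict G Q) P C s →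
           Equitable G P C s ⊎ ∃ λ v → Q v ≡ false × Equitable (restrict G (insert v Q)) P C s
    grow Q e = by-cases (Fin.any? λ v → Q v Bool.≟ false)
      where
      by-cases : Dec (∃ λ v → Q v ≡ false) → _
      by-cases (yes (v , Qv)) = inj₂ (v , Qv , activate Q e v)
      by-cases (no ∄) = inj₁ record
        { colour = colour ; colour∈ = colour∈ ; sizes = sizes
        ; proper = λ u v Pu Pv uv → proper u v Pu Pv (∧-intro uv (∧-intro (active u) (active v))) }
        where
        open Equitable e
        active : ∀ v → Q v ≡ true
        active v = Bool.¬-not λ Qv → ∄ (v , Qv)

hajnal-szemerédi : ∀ {n k} (G : Graph n) → Fin k → ∀ s P (C : Fin k → Bool) →
  count P ≡ count C * s → DegreeBelow G P (count C) → Equitable G P C s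
hajnal-szemerédi {n} {k} G d s P C = go G P C (<-wellFounded (count C))
  where
  -- The graph varies as well, because the theorem for fewer colours is applied while the edges are
  -- only partly inserted.
  go : ∀ (G : Graph n) P (C : Fin k → Bool) → Acc _<_ (count C) →
       count P ≡ count C * s → DegreeBelow G P (count C) → Equitable G P C s
  go G P C (acc rec) P≡ degree = Activation.equitable-colouring G P C s degree
    (λ G′ P′ C′ C′<C P′≡ → go G′ P′ C′ (rec C′<C) P′≡) d P≡

-- Packings of vertex subsets

opaque
  unfolding sum

  length-filter-tabulate : ∀ {A : Set} {Q : A → Set} (Q? : ∀ x → Dec (Q x)) (g : Fin n → A) →
    length (filter Q? (tabulate g)) ≡ count (λ i → does (Q? (g i)))
  length-filter-tabulate {zero}  Q? g = refl
  length-filter-tabulate {suc n} Q? g with does (Q? (g zero))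
  ... | true  = cong suc (length-filter-tabulate Q? (g ∘ suc))
  ... | false = length-filter-tabulate Q? (g ∘ suc)

-- Numbers the vertices of a clique so that it can be read as a tournament on `Fin m`.
enumerate : ∀ m (P : Fin n → Bool) → count P ≡ m → ∃ λ (e : Fin m → Fin n) →
  Injective _≡_ _≡_ e × (∀ i → P (e i) ≡ true) × (∀ v → P v ≡ true → ∃ λ i → e i ≡ v)
enumerate zero P P≡ = (λ ()) , (λ {i} → ⊥-elim (Fin.¬Fin0 i)) , (λ ()) , λ v Pv → false≢true (count≡0⇒false P≡ v) Pv
enumerate {n} (suc m) P P≡ with count>0⇒∃ (subst (0 <_) (sym P≡) z<s)
... | x , Px with enumerate m (λ v → P v ∧ not (v == x)) (suc-injective (trans (sym (count-remove x Px)) P≡))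
...   | e , e-inj , e∈ , e-onto = e′ , e′-inj , e′∈ , e′-onto
  where
  e′ : Fin (suc m) → Fin n
  e′ zero    = x
  e′ (suc i) = e i
  fresh : ∀ i → e i ≢ x
  fresh i eq = false≢true (cong not (trans (cong (_== x) eq) (==-refl x))) (∧-elimʳ {P (e i)} (e∈ i))
  e′-inj : Injective _≡_ _≡_ e′
  e′-inj {zero}  {zero}  _  = refl
  e′-inj {zero}  {suc j} eq = contradiction (sym eq) (fresh j)
  e′-inj {suc i} {zero}  eq = contradiction eq (fresh i)
  e′-inj {suc i} {suc j} eq = cong suc (e-inj eq)
  e′∈ : ∀ i → P (e′ i) ≡ true
  e′∈ zero    = Px
  e′∈ (suc i) = ∧-elimˡ (e∈ i)
  e′-onto : ∀ v → P v ≡ true → ∃ λ i → e′ i ≡ v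
  e′-onto v Pv with v ≟ x
  ... | yes refl = zero , refl
  ... | no v≢x with e-onto v (∧-intro Pv (cong not (==-≢ v≢x)))
  ...   | i , eq = suc i , eq

-- `PerfectPacking` relative to a vertex set, so that packings of disjoint sets in one graph can be
-- joined.
record PackingOf {h n} (H : OrientedGraph h) (G : OrientedGraph n) (P : Fin n → Bool) : Set where
  field
    size     : ℕ
    copy     : Fin size → Copy H G
    inside   : ∀ i a → P (vertex (copy i) a) ≡ true
    disjoint : ∀ {i j} → i ≢ j → ∀ a b → vertex (copy i) a ≢ vertex (copy j) b
    covers   : ∀ v → P v ≡ true → ∃₂ λ i a → vertex (copy i) a ≡ v

module Packings {h n : ℕ} (H : OrientedGraph h) (G : OrientedGraph n) where

  empty-packing : ∀ {P} → (∀ v → P v ≡ false) → PackingOf H G P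
  empty-packing ∅ = record
    { size = 0 ; copy = λ () ; inside = λ () ; disjoint = λ { {()} } ; covers = λ v Pv → false≢true (∅ v) Pv }

  resize : ∀ {P Q} → (∀ v → P v ≡ true → Q v ≡ true) → (∀ v → Q v ≡ true → P v ≡ true) →
           PackingOf H G P → PackingOf H G Q
  resize P⊆Q Q⊆P π = record
    { size = size ; copy = copy ; inside = λ i a → P⊆Q _ (inside i a) ; disjoint = disjoint
    ; covers = λ v Qv → covers v (Q⊆P v Qv) }
    where open PackingOf π

  union : ∀ {P Q R} → PackingOf H G P → PackingOf H G Q →
    (∀ v → P v ≡ true → R v ≡ true) → (∀ v → Q v ≡ true → R v ≡ true) →
    (∀ v → P v ≡ true → Q v ≡ false) → (∀ v → R v ≡ true → P v ≡ true ⊎ Q v ≡ true) →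
    PackingOf H G R
  union {P} {Q} {R} π ρ P⊆R Q⊆R apart R⊆ = record
    { size     = π.size + ρ.size
    ; copy     = copy ∘ Fin.splitAt π.size
    ; inside   = inside ∘ Fin.splitAt π.size
    ; disjoint = λ {i} {j} i≢j → disjoint (i≢j ∘ splitAt-injective i j)
    ; covers   = λ v Rv → [ covers-P v , covers-Q v ]′ (R⊆ v Rv)
    }
    where
    module π = PackingOf π
    module ρ = PackingOf ρ
    copy : Fin π.size ⊎ Fin ρ.size → Copy H G
    copy = [ π.copy , ρ.copy ]′
    inside : ∀ x a → R (vertex (copy x) a) ≡ true
    inside (inj₁ i) a = P⊆R _ (π.inside i a)
    inside (inj₂ j) a = Q⊆R _ (ρ.inside j a)
    disjoint : ∀ {x y} → x ≢ y → ∀ a b → vertex (copy x) a ≢ vertex (copy y) b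
    disjoint {inj₁ i} {inj₁ j} x≢y = π.disjoint (x≢y ∘ cong inj₁)
    disjoint {inj₂ i} {inj₂ j} x≢y = ρ.disjoint (x≢y ∘ cong inj₂)
    disjoint {inj₁ i} {inj₂ j} x≢y a b eq = false≢true (apart _ (π.inside i a))
      (subst (λ v → Q v ≡ true) (sym eq) (ρ.inside j b))
    disjoint {inj₂ i} {inj₁ j} x≢y a b eq = false≢true (apart _ (π.inside j b))
      (subst (λ v → Q v ≡ true) eq (ρ.inside i a))
    splitAt-injective : ∀ i j → Fin.splitAt π.size i ≡ Fin.splitAt π.size j → i ≡ j
    splitAt-injective i j eq = trans (sym (Fin.join-splitAt π.size ρ.size i))
      (trans (cong (Fin.join π.size ρ.size) eq) (Fin.join-splitAt π.size ρ.size j))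
    covers-P : ∀ v → P v ≡ true → ∃₂ λ i a → vertex (copy (Fin.splitAt π.size i)) a ≡ v
    covers-P v Pv with π.covers v Pv
    ... | i , a , eq = i Fin.↑ˡ ρ.size , a ,
      trans (cong (λ x → vertex (copy x) a) (Fin.splitAt-↑ˡ π.size i ρ.size)) eq
    covers-Q : ∀ v → Q v ≡ true → ∃₂ λ i a → vertex (copy (Fin.splitAt π.size i)) a ≡ v
    covers-Q v Qv with ρ.covers v Qv
    ... | j , a , eq = π.size Fin.↑ʳ j , a ,
      trans (cong (λ x → vertex (copy x) a) (Fin.splitAt-↑ʳ π.size ρ.size j)) eq

  union-of-fibres : ∀ {q} (f : Fin n → Fin q) P → (∀ X → PackingOf H G (λ v → P v ∧ f v == X)) →
                    PackingOf H G P
  union-of-fibres {q} f P π = saturate Inv grow (λ _ → false) (empty-packing λ v → Bool.∧-zeroʳ (P v))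
    where
    Inv : (Fin q → Bool) → Set
    Inv D = PackingOf H G (λ v → P v ∧ D (f v))
    grow : ∀ D → Inv D → PackingOf H G P ⊎ ∃ λ X → D X ≡ false × Inv (insert X D)
    grow D ρ with Fin.any? (λ X → D X Bool.≟ false)
    ... | no ∄ = inj₁ (resize (λ v → ∧-elimˡ)
            (λ v Pv → ∧-intro Pv (Bool.¬-not λ Df → ∄ (f v , Df))) ρ)
    ... | yes (X , DX) = inj₂ (X , DX , union ρ (π X)
            (λ v t → ∧-intro (∧-elimˡ t) (insert-there X D (∧-elimʳ {P v} t)))
            (λ v t → ∧-intro {P v} (∧-elimˡ t)
              (subst (λ Y → insert X D Y ≡ true) (sym (==⇒≡ {i = f v} {X} (∧-elimʳ {P v} t))) (insert-here X D)))
            (λ v t → ==-excluded (P v) λ _ eq → false≢true DX (subst (λ Y → D Y ≡ true) eq (∧-elimʳ {P v} t)))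
            (λ v t → split v (∧-elimˡ t) (∧-elimʳ {P v} t)))
      where
      split : ∀ v → P v ≡ true → insert X D (f v) ≡ true →
              P v ∧ D (f v) ≡ true ⊎ P v ∧ f v == X ≡ true
      split v Pv = insert-elim X D
        (λ eq → inj₂ (∧-intro Pv (subst (λ Y → f v == Y ≡ true) eq (==-refl (f v)))))
        (λ Df → inj₁ (∧-intro Pv Df))

  image : Copy H G → Fin n → Bool
  image κ v = does (Fin.any? λ a → vertex κ a ≟ v)

  image-intro : ∀ κ a → image κ (vertex κ a) ≡ true
  image-intro κ a = dec-true (Fin.any? λ b → vertex κ b ≟ vertex κ a) (a , refl)

  image-elim : ∀ κ {v} → image κ v ≡ true → ∃ λ a → vertex κ a ≡ v
  image-elim κ {v} t with Fin.any? (λ a → vertex κ a ≟ v)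
  ... | yes ex = ex

  singleton-packing : ∀ κ → PackingOf H G (image κ)
  singleton-packing κ = record
    { size     = 1
    ; copy     = λ _ → κ
    ; inside   = λ _ a → image-intro κ a
    ; disjoint = λ { {zero} {zero} i≢j → contradiction refl i≢j }
    ; covers   = λ v t → zero , image-elim κ t
    }

  count-image : ∀ κ → count (image κ) ≡ h
  count-image κ = begin
    count (image κ)                                 ≡⟨ sum-cong-≗ preimages ⟩
    sum (λ v → count (λ a → vertex κ a == v))       ≡⟨ ∑-comm _ ⟩
    sum (λ a → count (λ v → vertex κ a == v))       ≡⟨ sum-cong-≗ (λ a → trans (count-cong (λ v → ==-sym (vertex κ a) v)) (count-singleton (vertex κ a))) ⟩
    sum {h} (λ _ → 1)                               ≡⟨ sum-const h 1 ⟩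
    h * 1                                           ≡⟨ *-identityʳ h ⟩
    h                                               ∎
    where
    open ≡-Reasoning
    preimages : ∀ v → ⟦ image κ v ⟧ ≡ count (λ a → vertex κ a == v)
    preimages v with Fin.any? (λ a → vertex κ a ≟ v)
    ... | no ∄ = sym (trans (count-cong λ a → ==-≢ λ eq → ∄ (a , eq)) (sum-zero h))
    ... | yes (a , refl) = sym (trans (count-cong same) (count-singleton a))
      where
      same : ∀ b → vertex κ b == vertex κ a ≡ b == a
      same b with b ≟ a
      ... | yes refl = ==-refl (vertex κ a)
      ... | no b≢a = ==-≢ (b≢a ∘ injective κ)

-- The conflict graph and packings of its equitable classes

module Conflicts {n : ℕ} (G : OrientedGraph n) where
  open OrientedGraph G

  conflict : Graph n
  conflict = record
    { adj     = λ u v → not (u == v) ∧ (not (does (u ⟶? v)) ∧ not (does (v ⟶? u)))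
    ; adj-sym = λ u v → cong₂ (λ x y → not x ∧ y) (==-sym u v) (Bool.∧-comm (not (does (u ⟶? v))) _)
    ; adj-irr = λ v → cong (λ x → not x ∧ (not (does (v ⟶? v)) ∧ not (does (v ⟶? v)))) (==-refl v)
    }

  open Graph conflict

  ¬adj⇒edge : ∀ {u v} → u ≢ v → adj u v ≡ false → (u ⟶ v) ⊎ (v ⟶ u)
  ¬adj⇒edge {u} {v} u≢v uv with u ⟶? v | v ⟶? u
  ... | yes e | _     = inj₁ e
  ... | no  _ | yes e = inj₂ e
  ... | no  _ | no  _ = false≢true uv (cong (λ x → not x ∧ true) (==-≢ u≢v))

  -- Every vertex is exactly one of: `v` itself, in conflict with `v`, an out-neighbour, an
  -- in-neighbour. Asymmetry keeps the last two apart.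
  degree-conflict : ∀ v → suc (count (adj v)) + degree v ≡ n
  degree-conflict v = begin
    suc (count (adj v)) + (outdegree v + indegree v)
      ≡⟨ cong₂ (λ x y → suc (count (adj v)) + (x + y))
               (length-filter-tabulate (v ⟶?_) id) (length-filter-tabulate (_⟶? v) id) ⟩
    1 + count (adj v) + (count out + count into)
      ≡⟨ cong (λ x → x + count (adj v) + (count out + count into)) (count-singleton v) ⟨
    count (_== v) + count (adj v) + (count out + count into)
      ≡⟨ cong₂ _+_ (∑-distrib-+ _ _) (∑-distrib-+ _ _) ⟨
    sum (λ u → ⟦ u == v ⟧ + ⟦ adj v u ⟧) + sum (λ u → ⟦ out u ⟧ + ⟦ into u ⟧)
      ≡⟨ ∑-distrib-+ _ _ ⟨
    sum (λ u → ⟦ u == v ⟧ + ⟦ adj v u ⟧ + (⟦ out u ⟧ + ⟦ into u ⟧))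
      ≡⟨ sum-cong-≗ exactly-one ⟩
    sum {n} (λ _ → 1)
      ≡⟨ trans (sum-const n 1) (*-identityʳ n) ⟩
    n ∎
    where
    open ≡-Reasoning
    out into : Fin n → Bool
    out u = does (v ⟶? u)
    into u = does (u ⟶? v)
    exactly-one : ∀ u → ⟦ u == v ⟧ + ⟦ adj v u ⟧ + (⟦ out u ⟧ + ⟦ into u ⟧) ≡ 1
    exactly-one u = by-cases (u ≟ v)
      where
      by-cases : Dec (u ≡ v) → ⟦ u == v ⟧ + ⟦ adj v u ⟧ + (⟦ out u ⟧ + ⟦ into u ⟧) ≡ 1
      by-cases (yes refl) rewrite ==-refl v | dec-false (v ⟶? v) (irrefl refl) = refl
      by-cases (no u≢v) rewrite ==-≢ u≢v | ==-≢ (u≢v ∘ sym) with v ⟶? u | u ⟶? v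
      ... | yes vu | yes uv = contradiction uv (asym vu)
      ... | yes _  | no  _  = refl
      ... | no  _  | yes _  = refl
      ... | no  _  | no  _  = refl

module TournamentPacking {k m n : ℕ} (G : OrientedGraph n)
  (pack-tournament : (T : OrientedGraph m) → IsTournament T → PerfectPacking (TransitiveTournament k) T) where

  open OrientedGraph G
  open Packings (TransitiveTournament k) G
  open Conflicts G
  open Graph conflict

  pack-clique : ∀ P → count P ≡ m →
    (∀ {u v} → P u ≡ true → P v ≡ true → u ≢ v → (u ⟶ v) ⊎ (v ⟶ u)) →
    PackingOf (TransitiveTournament k) G P
  pack-clique P P≡m clique with enumerate m P P≡m
  ... | e , e-inj , e∈ , e-onto = record
    { size     = π.size
    ; copy     = λ i → record
      { vertex    = e ∘ vertex (π.copy i)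
      ; injective = injective (π.copy i) ∘ e-inj
      ; edge      = edge (π.copy i)
      }
    ; inside   = λ i a → e∈ (vertex (π.copy i) a)
    ; disjoint = λ i≢j a b → π.disjoint i≢j a b ∘ e-inj
    ; covers   = covers
    }
    where
    T : OrientedGraph m
    T = record
      { _⟶_    = λ i j → e i ⟶ e j
      ; _⟶?_   = λ i j → e i ⟶? e j
      ; irrefl = λ { refl → irrefl refl }
      ; asym   = asym
      }
    module π = PerfectPacking (pack-tournament T λ i j i≢j → clique (e∈ i) (e∈ j) (i≢j ∘ e-inj))
    covers : ∀ v → P v ≡ true → ∃₂ λ i a → e (vertex (π.copy i) a) ≡ v
    covers v Pv with e-onto v Pv
    ... | x , refl with π.covers x
    ...   | i , a , eq = i , a , cong e eq

  pack-multiple : ∀ q P → count P ≡ q * m → DegreeBelow conflict P q → PackingOf (TransitiveTournament k) G P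
  -- With `q = 0` there is no colour to hand to `hajnal-szemerédi`, but then `P` is empty.
  pack-multiple zero P P≡ _ = empty-packing (count≡0⇒false P≡)
  pack-multiple q@(suc _) P P≡ degree = union-of-fibres colour P λ X →
    pack-clique (λ v → P v ∧ colour v == X) (sizes X refl) (clique X)
    where
    all : Fin q → Bool
    all _ = true
    count-all : count all ≡ q
    count-all = trans (sum-const q 1) (*-identityʳ q)
    open Equitable (hajnal-szemerédi conflict zero m P all (trans P≡ (cong (_* m) (sym count-all)))
                      (subst (DegreeBelow conflict P) (sym count-all) degree))
    clique : ∀ X {u v} → P u ∧ colour u == X ≡ true → P v ∧ colour v == X ≡ true →
             u ≢ v → (u ⟶ v) ⊎ (v ⟶ u)
    clique X {u} {v} u∈ v∈ u≢v = ¬adj⇒edge u≢v (Bool.¬-not λ uv →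
      proper u v (∧-elimˡ u∈) (∧-elimˡ v∈) uv
        (trans (==⇒≡ {i = colour u} {X} (∧-elimʳ {P u} u∈)) (sym (==⇒≡ {i = colour v} {X} (∧-elimʳ {P v} v∈)))))

  degree-subset : ∀ {q P Q} → (∀ v → Q v ≡ true → P v ≡ true) →
    DegreeBelow conflict P q → DegreeBelow conflict Q q
  degree-subset {Q = Q} Q⊆P degree v Qv = ≤-<-trans
    (count-mono λ u t → ∧-intro (Q⊆P u (∧-elimˡ t)) (∧-elimʳ {Q u} t)) (degree v (Q⊆P v Qv))

  module _ .{{_ : NonZero k}} .{{_ : NonZero m}} where

    -- A packing of any qm vertices provides a copy.
    find-copy : ∀ q P → q * m < count P → DegreeBelow conflict P q →
                ∃ λ (κ : Copy (TransitiveTournament k) G) → ∀ a → P (vertex κ a) ≡ true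
    find-copy q P large degree = copy i , λ a → Q⊆P _ (inside i a)
      where
      v = count>0⇒∃ (≤-<-trans z≤n large)
      part = subset P (q * m) (<⇒≤ large)
      Q = proj₁ part
      Q⊆P = proj₁ (proj₂ part)
      Q≡ = proj₂ (proj₂ part)
      open PackingOf (pack-multiple q Q Q≡ (degree-subset Q⊆P degree))
      -- `P` has a vertex, and its conflict degree is strictly below `q`. With `m` positive, `Q` is
      -- then non-empty and its packing contains a copy.
      0<q : 0 < q
      0<q = ≤-<-trans z≤n (degree (proj₁ v) (proj₂ v))
      w = count>0⇒∃ (subst (0 <_) (sym Q≡) (*-mono-≤ 0<q (>-nonZero⁻¹ m)))
      i = proj₁ (covers (proj₁ w) (proj₂ w))

    pack : ∀ j q P → count P ≡ q * m + j * k → DegreeBelow conflict P q →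
           PackingOf (TransitiveTournament k) G P
    pack zero    q P P≡ degree = pack-multiple q P (trans P≡ (+-identityʳ (q * m))) degree
    pack (suc j) q P P≡ degree = union (singleton-packing κ) (pack j q P′ P′≡ (degree-subset (λ v → ∧-elimˡ) degree))
      image⊆P (λ v → ∧-elimˡ)
      (λ v t → trans (cong (λ x → P v ∧ not x) t) (Bool.∧-zeroʳ (P v)))
      split
      where
      found = find-copy q P (subst (q * m <_) (sym P≡) (m<m+n (q * m) (<-≤-trans (>-nonZero⁻¹ k) (m≤m+n k (j * k))))) degree
      κ = proj₁ found
      P′ : Fin n → Bool
      P′ v = P v ∧ not (image κ v)
      image⊆P : ∀ v → image κ v ≡ true → P v ≡ true
      image⊆P v t with image-elim κ t
      ... | a , refl = proj₂ found a
      P′≡ : count P′ ≡ q * m + j * k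
      P′≡ = +-cancelˡ-≡ k _ _ (begin
        k + count P′                                      ≡⟨ cong (_+ count P′) (count-image κ) ⟨
        count (image κ) + count P′                        ≡⟨ cong (_+ count P′) (count-cong in-P) ⟨
        count (λ v → P v ∧ image κ v) + count P′          ≡⟨ count-split P (image κ) ⟩
        count P                                           ≡⟨ P≡ ⟩
        q * m + (k + j * k)                               ≡⟨ swap (q * m) k (j * k) ⟩
        k + (q * m + j * k)                               ∎)
        where
        open ≡-Reasoning
        swap : ∀ x y z → x + (y + z) ≡ y + (x + z)
        swap = solve-∀
        in-P : ∀ v → P v ∧ image κ v ≡ image κ v
        in-P v with image κ v in eq
        ... | true  = trans (Bool.∧-identityʳ (P v)) (image⊆P v eq)
        ... | false = Bool.∧-zeroʳ (P v)
      split : ∀ v → P v ≡ true → image κ v ≡ true ⊎ P′ v ≡ true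
      split v Pv with image κ v
      ... | true  = inj₁ refl
      ... | false = inj₂ (∧-intro Pv refl)

-- From the minimum degree to the conflict degree

δ≤degree : ∀ (G : OrientedGraph n) v → δ G ≤ OrientedGraph.degree G v
δ≤degree {n} G v = All.lookup (min≤xs n (map (OrientedGraph.degree G) (allFin n)))
                       (∈-map⁺ (OrientedGraph.degree G) (∈-allFin v))

open import Data.Integer.Base using (+_)

-- The bound multiplied by `m`, with `n` moved across so that no subtraction is left. In
-- unnormalised rationals the numerator and denominator of the product compute.
clear-fractions : ∀ m .{{_ : NonZero m}} n d →
  (+ d) ℚ./ 1 ℚ.≥ (ℚ.1ℚ ℚ.- (+ 1) ℚ./ m) ℚ.* ((+ n) ℚ./ 1) → n * m ≤ d * m + n
clear-fractions m@(suc m′) n d bound = ℤ.drop‿+≤+ (begin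
  + (n * m)                          ≡⟨ ℤ.pos-* n m ⟩
  + n ℤ.* + m                        ≡⟨ expand (+ n) (+ m) ⟩
  numerator ℤ.* ℤ.1ℤ ℤ.+ + n         ≤⟨ ℤ.+-monoˡ-≤ (+ n) (ℚᵘ.drop-*≤* unnormalised) ⟩
  + d ℤ.* ℚᵘ.ℚᵘ.denominator product ℤ.+ + n
                                     ≡⟨ cong (λ x → + d ℤ.* + x ℤ.+ + n) (trans (*-identityʳ (1 * m)) (*-identityˡ m)) ⟩
  + d ℤ.* + m ℤ.+ + n                ≡⟨ cong (ℤ._+ + n) (ℤ.pos-* d m) ⟨
  + (d * m) ℤ.+ + n                  ≡⟨ ℤ.pos-+ (d * m) n ⟨
  + (d * m + n)                      ∎)
  where
  open ℤ.≤-Reasoning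
  product : ℚᵘ.ℚᵘ
  product = (ℚᵘ.1ℚᵘ ℚᵘ.- ℚᵘ.mkℚᵘ (+ 1) m′) ℚᵘ.* ℚᵘ.mkℚᵘ (+ n) 0
  numerator : ℤ.ℤ
  numerator = ℚᵘ.ℚᵘ.numerator product
  expand : ∀ n m → n ℤ.* m ≡ (ℤ.1ℤ ℤ.* m ℤ.+ ℤ.-1ℤ ℤ.* ℤ.1ℤ) ℤ.* n ℤ.* ℤ.1ℤ ℤ.+ n
  expand = ℤ-Solver.solve-∀
  to-product : ℚ.toℚᵘ ((ℚ.1ℚ ℚ.- (+ 1) ℚ./ m) ℚ.* ((+ n) ℚ./ 1)) ℚᵘ.≃ product
  to-product = ℚᵘ.≃-trans (ℚ.toℚᵘ-homo-* (ℚ.1ℚ ℚ.- (+ 1) ℚ./ m) ((+ n) ℚ./ 1))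
    (ℚᵘ.*-cong
      (ℚᵘ.≃-trans (ℚ.toℚᵘ-homo-+ ℚ.1ℚ (ℚ.- ((+ 1) ℚ./ m)))
        (ℚᵘ.+-congʳ ℚᵘ.1ℚᵘ (ℚᵘ.≃-trans (ℚ.toℚᵘ-homo‿- ((+ 1) ℚ./ m))
          (ℚᵘ.-‿cong (ℚ.toℚᵘ-fromℚᵘ (ℚᵘ.mkℚᵘ (+ 1) m′))))))
      (ℚ.toℚᵘ-fromℚᵘ (ℚᵘ.mkℚᵘ (+ n) 0)))
  unnormalised : product ℚᵘ.≤ ℚᵘ.mkℚᵘ (+ d) 0
  unnormalised = ℚᵘ.≤-respʳ-≃ (ℚ.toℚᵘ-fromℚᵘ (ℚᵘ.mkℚᵘ (+ d) 0))
    (ℚᵘ.≤-respˡ-≃ to-product (ℚ.toℚᵘ-mono-≤ bound))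

-- By `degree-conflict`, `n` is `D + suc c`, so the hypothesis reduces to `suc c * m ≤ n`. Since
-- `suc c` is an integer, it is at most the floor `n / m`.
conflict-degree-below : ∀ (G : OrientedGraph n) m .{{_ : NonZero m}} → n * m ≤ δ G * m + n →
  DegreeBelow (Conflicts.conflict G) (λ _ → true) (n / m)
conflict-degree-below {n} G m bound v _ = begin
  suc c              ≡⟨ m*n/n≡m (suc c) m ⟨
  (suc c * m) / m    ≤⟨ /-monoˡ-≤ m (+-cancelˡ-≤ (D * m) _ _ scaled) ⟩
  n / m              ∎
  where
  open ≤-Reasoning
  D = OrientedGraph.degree G v
  c = count (Graph.adj (Conflicts.conflict G) v)
  scaled : D * m + suc c * m ≤ D * m + n
  scaled = begin
    D * m + suc c * m    ≡⟨ *-distribʳ-+ m D (suc c) ⟨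
    (D + suc c) * m      ≡⟨ cong (_* m) (trans (+-comm D (suc c)) (Conflicts.degree-conflict G v)) ⟩
    n * m                ≤⟨ bound ⟩
    δ G * m + n          ≤⟨ +-monoˡ-≤ n (*-monoˡ-≤ m (δ≤degree G v)) ⟩
    D * m + n            ∎

proposition9 : (k : ℕ) .{{_ : NonZero k}} →
    (m : ℕ) .{{_ : NonZero m}} → IsTilingRamseyNumber k m →
    (n : ℕ) (G : OrientedGraph n) → k ∣ n →
    (+ (δ G)) ℚ./ 1 ℚ.≥ (ℚ.1ℚ ℚ.- (+ 1) ℚ./ m) ℚ.* ((+ n) ℚ./ 1) →
    PerfectPacking (TransitiveTournament k) G
proposition9 k m isTR n G k∣n bound = record
  { size = size ; copy = copy ; disjoint = disjoint ; covers = λ v → covers v refl }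
  where
  open TournamentsPack (IsTilingRamseyNumber.packs isTR)
  -- The `n % m` vertices beyond `n / m * m` are those to be removed in single copies, hence the
  -- divisibility by `k`.
  k∣rest : k ∣ n % m
  k∣rest = ∣m+n∣m⇒∣n (subst (k ∣_) (trans (m≡m%n+[m/n]*n n m) (+-comm (n % m) _)) k∣n)
                     (∣n⇒∣m*n (n / m) divisible)
  all≡ : count {n} (λ _ → true) ≡ n / m * m + quotient k∣rest * k
  all≡ = begin
    count {n} (λ _ → true)              ≡⟨ sum-const n 1 ⟩
    n * 1                               ≡⟨ *-identityʳ n ⟩
    n                                   ≡⟨ m≡m%n+[m/n]*n n m ⟩
    n % m + n / m * m                   ≡⟨ +-comm (n % m) _ ⟩
    n / m * m + n % m                   ≡⟨ cong (λ r → n / m * m + r) (_∣_.equality k∣rest) ⟩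
    n / m * m + quotient k∣rest * k     ∎
    where open ≡-Reasoning
  open PackingOf (TournamentPacking.pack G packing (quotient k∣rest) (n / m) (λ _ → true) all≡
                   (conflict-degree-below G m (clear-fractions m n (δ G) bound)))
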